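{- Consider the permutation walk associated with $\Omega, F=\{f_1,\dots,f_m\}, D,\rho,\theta$ and a permutation $\pi$ of $F$, let $\mu$ be a probability measure on $\Omega$ with $\mu(\sigma)>0$ for all $\sigma$, and let $\gamma_i$ be the charge of $f_i$, as defined in the context. If there exist positive real numbers $\{\psi_i\}_{i=1}^m$ such that for every $i\in[m]$, $$\zeta_i := \frac{\gamma_i}{\psi_i}\sum_{S\subseteq \Gamma(i)}\ \prod_{j\in S}\psi_j < 1,$$ then for every permutation $\pi$ of $F$ and every $s\ge 0$ the permutation walk reaches a sink of $D$ within $(T_0+s)/\delta$ steps with probability at least $1-2^{ -s}$, where $\delta = 1-\max_{i\in[m]}\zeta_i>0$ and $$T_0=\log_2\left(\max_{\sigma\in\Omega}\frac{\theta(\sigma)}{\mu(\sigma)}\right)+\log_2\left(\sum_{S\subseteq \mathcal{S}(\theta)}\ \prod_{j\in S}\psi_j\right).$$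
   Context: $\Omega$ is a finite set of states and $F=\{f_1,\dots,f_m\}$ is a collection of non-empty subsets of $\Omega$ called flaws; flaws are identified with their indices in $[m]$. For $\sigma\in\Omega$, $U(\sigma)=\{f\in F:\sigma\in f\}$ is the set of flaws present in $\sigma$; $\sigma$ is flawless if $U(\sigma)=\emptyset$. For every $\sigma$ and every $f_i\in U(\sigma)$ a non-empty set $A(i,\sigma)\subseteq\Omega$ of actions, with $A(i,\sigma)\neq\{\sigma\}$, is given. $D$ is the multi-digraph on $\Omega$ having an arc $\sigma\xrightarrow{i}\tau$ for every $f_i\in U(\sigma)$ and $\tau\in A(i,\sigma)$; its sinks are exactly the flawless states. For $\sigma\in f_i$, $\rho_i(\sigma,\cdot)$ is a probability distribution on $A(i,\sigma)$ (with $\rho_i(\sigma,\tau)=0$ for $\tau\notin A(i,\sigma)$). $\theta$ is a probability distribution on $\Omega$. Empty products equal $1$. Permutation walk: the initial state $\sigma_1$ is chosen according to $\theta$; at each flawed state $\sigma$ the walk addresses the flaw $f_i\in U(\sigma)$ that is greatest according to $\pi$, moving to $\tau\in A(i,\sigma)$ with probability $\rho_i(\sigma,\tau)$ (this is one step). It stops at a sink. Causality: for an arc $\sigma\xrightarrow{i}\tau$ of $D$ and a flaw $f_j$ present in $\tau$, $f_i$ causes $f_j$ if $f_j=f_i$ or $\sigma\notin f_j$. The (potential) causality digraph $C$ on $[m]$ has an arc $i\to j$ iff there is some arc of $D$ in which $f_i$ causes $f_j$; $\Gamma(i)=\{j: i\to j \text{ in } C\}$ (possibly containing $i$). Charges: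 $b_i^\tau=|\{\sigma\in f_i:\tau\in A(i,\sigma)\}|$ and $b_i=\max_{\tau\in\Omega} b_i^\tau$. $D$ is atomic if $b_i=1$ for all $i$. $(D,\rho)$ regenerate $\mu$ at $f_i$ if $\frac{1}{\mu(f_i)}\sum_{\sigma\in f_i}\mu(\sigma)\rho_i(\sigma,\tau)=\mu(\tau)$ for every $\tau\in\Omega$. If $(D,\rho)$ regenerate $\mu$ at every $f_i\in F$ and either $\theta=\mu$ or $D$ is atomic (regenerative case), then $\gamma_i=\mu(f_i)$. Otherwise (general case) $\gamma_i=b_i\max_{\sigma\in f_i}\lambda_i^\sigma$ where $\lambda_i^\sigma=\max_{\tau\in A(i,\sigma)}\left\{\rho_i(\sigma,\tau)\frac{\mu(\sigma)}{\mu(\tau)}\right\}$. The span of $\theta$ is $\mathcal{S}(\theta)=\bigcup_{\sigma:\theta(\sigma)>0}U(\sigma)$. -}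

module Defs where

open import Algebra.Bundles using (CommutativeRing)
open import Algebra.Core using (Op₁)
import Algebra.Definitions.RawMonoid as MonoidOps
open import Data.Bool.Base using (Bool; true; false; if_then_else_)
open import Data.Fin.Base as Fin using (Fin)
open import Data.Fin.Permutation using (Permutation′; _⟨$⟩ʳ_)
open import Data.Fin.Properties as Finₚ using (any?; all?)
open import Data.Fin.Subset using (Subset; _∈_; _∉_; ⁅_⁆; Nonempty)
open import Data.Fin.Subset.Properties using (_∈?_; _⊆?_)
open import Data.List.Base
  using (List; []; _∷_; foldr; map; filter; length; allFin; cartesianProductWith)
import Data.List.Extrema as Extrema
import Data.List.Extrema.Nat as ℕExtrema
open import Data.Nat.Base using (ℕ; zero; suc)
import Data.Nat.Properties as ℕₚ
open import Data.Product.Base using (∃; ∃-syntax; _×_; _,_)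
open import Data.Sum.Base using (_⊎_)
open import Data.Vec.Base as Vec using (Vec)
import Data.Vec.Relation.Unary.Any as VecAny
open import Level using (_⊔_) renaming (suc to lsuc)
open import Relation.Binary.Bundles using (TotalOrder)
open import Relation.Binary.Core using (Rel)
open import Relation.Binary.Definitions using () renaming (Decidable to Decidable₂)
open import Relation.Binary.PropositionalEquality.Core using (_≡_; _≢_)
open import Relation.Binary.Structures using (IsDecTotalOrder)
open import Relation.Nullary.Decidable
  using (Dec; yes; no; does; ¬?; _×-dec_; _⊎-dec_; _→-dec_)
open import Relation.Nullary.Negation using (¬_)
open import Relation.Unary using (Pred; Decidable)

-- The classical axioms of a complete ordered field, up to a setoid
-- equality, together with x ↦ 2ˣ and log₂.  Classically they determine it up
-- to unique isomorphism, except for the irrelevant values of _⁻¹ at 0 and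
-- of log₂ at non-positive arguments.

record Reals c ℓ₁ ℓ₂ : Set (lsuc (c ⊔ ℓ₁ ⊔ ℓ₂)) where
  infix  4 _≤_ _<_
  infixl 7 _/_
  infix  8 _⁻¹
  infixr 9 2^_

  field
    commutativeRing : CommutativeRing c ℓ₁

  open CommutativeRing commutativeRing public
    using (Carrier; _≈_; _+_; _*_; -_; _-_; 0#; 1#; +-rawMonoid)

  field
    _≤_             : Rel Carrier ℓ₂
    isDecTotalOrder : IsDecTotalOrder _≈_ _≤_
    _⁻¹             : Op₁ Carrier

  _<_ : Rel Carrier (ℓ₁ ⊔ ℓ₂)
  x < y = x ≤ y × ¬ x ≈ y

  _/_ : Carrier → Carrier → Carrier
  x / y = x * y ⁻¹

  fromℕ : ℕ → Carrier
  fromℕ k = MonoidOps._×_ +-rawMonoid k 1#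

  UpperBound : ∀ {p} → Pred Carrier p → Pred Carrier (c ⊔ ℓ₂ ⊔ p)
  UpperBound P u = ∀ x → P x → x ≤ u

  field
    0≉1         : ¬ 0# ≈ 1#
    ⁻¹-cong     : ∀ {x y} → x ≈ y → x ⁻¹ ≈ y ⁻¹
    *-inverseʳ  : ∀ x → ¬ x ≈ 0# → x * x ⁻¹ ≈ 1#
    +-monoˡ-≤   : ∀ z {x y} → x ≤ y → x + z ≤ y + z
    *-nonNeg    : ∀ {x y} → 0# ≤ x → 0# ≤ y → 0# ≤ x * y
    -- Classically a consequence of completeness.
    archimedean : ∀ x → ∃[ k ] x ≤ fromℕ k
    complete    : (P : Pred Carrier (c ⊔ ℓ₁ ⊔ ℓ₂)) → ∃ P → ∃ (UpperBound P) →
                  ∃[ s ] UpperBound P s × (∀ u → UpperBound P u → s ≤ u)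

    -- The monotone homomorphism from addition to multiplication with value 2
    -- at 1 is unique.
    2^_         : Op₁ Carrier
    2^-homo     : ∀ x y → 2^ (x + y) ≈ 2^ x * 2^ y
    2^-one      : 2^ 1# ≈ 1# + 1#
    2^-mono-≤   : ∀ {x y} → x ≤ y → 2^ x ≤ 2^ y
    log₂        : Op₁ Carrier
    2^-log₂     : ∀ x → 0# < x → 2^ (log₂ x) ≈ x

  open IsDecTotalOrder isDecTotalOrder public using (_≟_; _≤?_)

  totalOrder : TotalOrder c ℓ₁ ℓ₂
  totalOrder = record
    { isTotalOrder = IsDecTotalOrder.isTotalOrder isDecTotalOrder }

  _<?_ : Decidable₂ _<_
  x <? y = x ≤? y ×-dec ¬? (x ≟ y)

  ∑ : ∀ {a} {A : Set a} → List A → (A → Carrier) → Carrier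
  ∑ xs f = foldr (λ x s → f x + s) 0# xs

  ∏ : ∀ {a} {A : Set a} → List A → (A → Carrier) → Carrier
  ∏ xs f = foldr (λ x s → f x * s) 1# xs

  -- Only used for families of non-negative numbers, where the base value 0
  -- matters only for the empty family.
  maximum : ∀ {a} {A : Set a} → List A → (A → Carrier) → Carrier
  maximum xs f = Extrema.max totalOrder 0# (map f xs)

comprehension : ∀ {n p} {P : Pred (Fin n) p} → Decidable P → Subset n
comprehension P? = Vec.tabulate (λ i → does (P? i))

elements : ∀ {n} → Subset n → List (Fin n)
elements S = filter (_∈? S) (allFin _)

vectors : ∀ {a} {A : Set a} → List A → (k : ℕ) → List (Vec A k)
vectors xs zero    = Vec.[] ∷ []
vectors xs (suc k) = cartesianProductWith Vec._∷_ xs (vectors xs k)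

subsetsOf : ∀ {n} → Subset n → List (Subset n)
subsetsOf {n} S = filter (_⊆? S) (vectors (true ∷ false ∷ []) n)

-- The state space is Fin n and flaws are indexed by Fin m.  A i σ is only
-- meaningful when σ ∈ flaw i.

record FlawDigraph (n m : ℕ) : Set where
  field
    flaw          : Fin m → Subset n
    flaw-nonempty : ∀ i → Nonempty (flaw i)
    A             : Fin m → Fin n → Subset n
    A-nonempty    : ∀ {i σ} → σ ∈ flaw i → Nonempty (A i σ)
    A-nontrivial  : ∀ {i σ} → σ ∈ flaw i → A i σ ≢ ⁅ σ ⁆

  U : Fin n → Subset m
  U σ = comprehension (λ i → σ ∈? flaw i)

  Arc : Fin m → Fin n → Fin n → Set
  Arc i σ τ = σ ∈ flaw i × τ ∈ A i σ

  arc? : ∀ i σ τ → Dec (Arc i σ τ)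
  arc? i σ τ = σ ∈? flaw i ×-dec τ ∈? A i σ

  Sink : Pred (Fin n) _
  Sink σ = ∀ i τ → ¬ Arc i σ τ

  sink? : Decidable Sink
  sink? σ = all? (λ i → all? (λ τ → ¬? (arc? i σ τ)))

  -- Only meaningful on an arc σ →ⁱ τ.
  Causes : Fin n → Fin n → Fin m → Fin m → Set
  Causes σ τ i j = τ ∈ flaw j × (j ≡ i ⊎ σ ∉ flaw j)

  causes? : ∀ σ τ i j → Dec (Causes σ τ i j)
  causes? σ τ i j = τ ∈? flaw j ×-dec (j Finₚ.≟ i ⊎-dec ¬? (σ ∈? flaw j))

  CausalityArc : Fin m → Fin m → Set
  CausalityArc i j = ∃[ σ ] ∃[ τ ] Arc i σ τ × Causes σ τ i j

  causalityArc? : ∀ i j → Dec (CausalityArc i j)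
  causalityArc? i j =
    any? (λ σ → any? (λ τ → arc? i σ τ ×-dec causes? σ τ i j))

  Γ : Fin m → Subset m
  Γ i = comprehension (causalityArc? i)

  bᵗ : Fin m → Fin n → ℕ
  bᵗ i τ = length (filter (λ σ → arc? i σ τ) (allFin n))

  b : Fin m → ℕ
  b i = ℕExtrema.max 0 (map (bᵗ i) (allFin n))

  Atomic : Set
  Atomic = ∀ i → b i ≡ 1

  atomic? : Dec Atomic
  atomic? = all? (λ i → b i ℕₚ.≟ 1)

module _ {c ℓ₁ ℓ₂} (ℝ : Reals c ℓ₁ ℓ₂) where
  open Reals ℝ

  record IsDistribution {n} (p : Fin n → Carrier) : Set (ℓ₁ ⊔ ℓ₂) where
    field
      nonNeg : ∀ σ → 0# ≤ p σ
      total  : ∑ (allFin n) p ≈ 1#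

  module _ {n m} (D : FlawDigraph n m) where
    open FlawDigraph D

    record IsTransition (ρ : Fin m → Fin n → Fin n → Carrier) : Set (ℓ₁ ⊔ ℓ₂) where
      field
        isDistribution : ∀ {i σ} → σ ∈ flaw i → IsDistribution (ρ i σ)
        support        : ∀ {i σ τ} → σ ∈ flaw i → τ ∉ A i σ → ρ i σ τ ≈ 0#

module PermutationWalk
  {c ℓ₁ ℓ₂} (ℝ : Reals c ℓ₁ ℓ₂) {n m} (D : FlawDigraph n m)
  (ρ : Fin m → Fin n → Fin n → Reals.Carrier ℝ) (θ : Fin n → Reals.Carrier ℝ)
  where

  open Reals ℝ
  open FlawDigraph D

  measure : (Fin n → Carrier) → Subset n → Carrier
  measure μ S = ∑ (elements S) μ

  Greatest : Permutation′ m → Fin n → Fin m → Set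
  Greatest π σ i = i ∈ U σ × (∀ j → j ∈ U σ → (π ⟨$⟩ʳ j) Fin.≤ (π ⟨$⟩ʳ i))

  greatest? : ∀ π σ i → Dec (Greatest π σ i)
  greatest? π σ i =
    i ∈? U σ ×-dec all? (λ j → j ∈? U σ →-dec ((π ⟨$⟩ʳ j) Finₚ.≤? (π ⟨$⟩ʳ i)))

  -- There is no greatest flaw exactly when
  -- σ is flawless; the walk stops there, modelled by staying at σ.
  step : Permutation′ m → Fin n → Fin n → Carrier
  step π σ τ with any? (greatest? π σ)
  ... | yes (i , _) = ρ i σ τ
  ... | no  _       = if does (τ Finₚ.≟ σ) then 1# else 0#

  steps : Permutation′ m → ∀ {t} → Vec (Fin n) (suc t) → Carrier
  steps π (σ Vec.∷ Vec.[])        = 1#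
  steps π (σ Vec.∷ w@(τ Vec.∷ _)) = step π σ τ * steps π w

  pathProbability : Permutation′ m → ∀ {t} → Vec (Fin n) (suc t) → Carrier
  pathProbability π w = θ (Vec.head w) * steps π w

  -- A path with t steps has suc t states.
  Pr[sink-within_steps] : ℕ → Permutation′ m → Carrier
  Pr[sink-within t steps] π =
    ∑ (filter (VecAny.any? sink?) (vectors (allFin n) (suc t))) (pathProbability π)

  -- For a real bound x: the event that the walk reaches a sink after some
  -- number t ≤ x of steps has probability at least p.
  ReachesSinkWithin : Permutation′ m → Carrier → Carrier → Set ℓ₂
  ReachesSinkWithin π x p = ∃[ t ] fromℕ t ≤ x × p ≤ Pr[sink-within t steps] π

  span : Subset m
  span = comprehension (λ i → any? (λ σ → 0# <? θ σ ×-dec i ∈? U σ))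

  module Charges (μ : Fin n → Carrier) where

    Regenerates : Fin m → Set ℓ₁
    Regenerates i = ∀ τ →
      measure μ (flaw i) ⁻¹ * ∑ (elements (flaw i)) (λ σ → μ σ * ρ i σ τ) ≈ μ τ

    RegenerativeCase : Set ℓ₁
    RegenerativeCase = (∀ i → Regenerates i) × ((∀ σ → θ σ ≈ μ σ) ⊎ Atomic)

    regenerativeCase? : Dec RegenerativeCase
    regenerativeCase? =
      all? (λ i → all? (λ τ → _ ≟ _)) ×-dec (all? (λ σ → θ σ ≟ μ σ) ⊎-dec atomic?)

    λᵢ : Fin m → Fin n → Carrier
    λᵢ i σ = maximum (elements (A i σ)) (λ τ → ρ i σ τ * (μ σ / μ τ))

    γ : Fin m → Carrier
    γ i = if does regenerativeCase?
          then measure μ (flaw i)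
          else fromℕ (b i) * maximum (elements (flaw i)) (λᵢ i)

    module _ (ψ : Fin m → Carrier) where

      weight : Subset m → Carrier
      weight R = ∑ (subsetsOf R) (λ S → ∏ (elements S) ψ)

      ζ : Fin m → Carrier
      ζ i = (γ i / ψ i) * weight (Γ i)

      δ : Carrier
      δ = 1# - maximum (allFin m) ζ

      T₀ : Carrier
      T₀ = log₂ (maximum (allFin n) (λ σ → θ σ / μ σ)) + log₂ (weight span)

{-# OPTIONS --safe #-}
module Submission where

open import Defs
open import Algebra.Bundles using (CommutativeRing)
import Algebra.Properties.Ring as RingProperties
import Algebra.Solver.Ring.NaturalCoefficients.Default as SemiringSolver
open import Data.Bool.Base as Bool using (Bool; true; false; not; _∧_; _∨_; if_then_else_)
open import Data.Empty using (⊥-elim)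
open import Data.Fin.Base as Fin using (Fin; toℕ)
open import Data.Fin.Permutation using (Permutation′; _⟨$⟩ʳ_; _⟨$⟩ˡ_; inverseˡ)
import Data.Fin.Properties as Finₚ
open import Data.Fin.Subset using (Subset; _∈_)
open import Data.Fin.Subset.Properties using (_∈?_; _⊆?_)
open import Data.List.Base
  using (List; []; _∷_; _++_; map; filter; length; allFin; cartesianProductWith)
import Data.List.Extrema as Extrema
import Data.List.Extrema.Nat as ℕExtrema
open import Data.List.Membership.Propositional using () renaming (_∈_ to _∈ˡ_)
open import Data.List.Membership.Propositional.Properties using (∈-allFin; ∈-filter⁺; ∈-map⁺)
open import Data.List.Properties using (map-tabulate)
open import Data.List.Relation.Unary.All as All using ()
import Data.List.Relation.Unary.All.Properties as Allₚ
open import Data.List.Relation.Unary.Any using (here; there)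
open import Data.Nat.Base as ℕ using (ℕ; zero; suc; _<ᵇ_)
import Data.Nat.Properties as ℕₚ
open import Data.Product.Base using (_×_; _,_; proj₁; proj₂; ∃; ∃-syntax)
open import Data.Sum.Base using (inj₁; inj₂)
open import Data.Vec.Base as Vec using (Vec; lookup)
import Data.Vec.Properties as Vecₚ
import Data.Vec.Relation.Unary.Any as VecAny
open import Function.Base using (_∘_)
open import Relation.Binary.Bundles using (TotalOrder)
open import Relation.Binary.PropositionalEquality.Core as ≡ using (_≡_)
import Relation.Binary.Reasoning.PartialOrder as PosetReasoning
open import Relation.Binary.Structures using (IsDecTotalOrder)
open import Relation.Nullary.Decidable using (Dec; does; yes; no; _×-dec_; dec-true)
open import Relation.Nullary.Negation using (¬_)
open import Relation.Unary using (Pred; Decidable)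

-- Write w(V) = ∏_{j ∈ V} (1 + ψ_j) = ∑_{S ⊆ V} ∏_{j ∈ S} ψ_j and z = max ζ_i.
-- By induction on t: if p ≤ c μ is a non-negative weight on states all of whose
-- flaws lie in V, then starting from p the walk makes t further steps with total
-- mass at most c zᵗ w(V).  Split p according to the addressed flaw i, the
-- greatest one present.  The mass carried to τ is at most c γ_i μ(τ), whichever
-- definition of the charge applies, and a flaw present at τ is either a smaller
-- element of V or caused by i, so it lies in V' = V_{<i} ∪ Γ(i), where
-- γ_i w(V') ≤ γ_i w(V_{<i}) w(Γ(i)) ≤ z ψ_i w(V_{<i}).  Grouping the subsets of V
-- by their greatest element gives ∑_{i ∈ V} ψ_i w(V_{<i}) ≤ w(V).
--
-- A walk that meets no sink within t = ⌊(T₀ + s) / δ⌋ steps makes t + 1 steps, so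
-- its probability is at most 2^T₀ (1 - δ)^(t + 1) ≤ 2^(T₀ - δ (t + 1)) ≤ 2^-s, using
-- 1 - δ ≤ 2^-δ on [0, 1].

-- Inequalities in an ordered field.

module OrderedField {c ℓ₁ ℓ₂} (ℝ : Reals c ℓ₁ ℓ₂) where
  open Reals ℝ
  module R = CommutativeRing commutativeRing
  module O = IsDecTotalOrder isDecTotalOrder
  open RingProperties R.ring using (-‿distribʳ-*; -‿involutive)
  open SemiringSolver R.commutativeSemiring public using (solve; con; _:=_; _:+_; _:*_)
  open PosetReasoning (TotalOrder.poset totalOrder)

  +-mono-≤ : ∀ {x y u v} → x ≤ y → u ≤ v → x + u ≤ y + v
  +-mono-≤ {x} {y} {u} {v} x≤y u≤v = begin
    x + u ≤⟨ +-monoˡ-≤ u x≤y ⟩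
    y + u ≈⟨ R.+-comm y u ⟩
    u + y ≤⟨ +-monoˡ-≤ y u≤v ⟩
    v + y ≈⟨ R.+-comm v y ⟩
    y + v ∎

  +-nonNeg : ∀ {x y} → 0# ≤ x → 0# ≤ y → 0# ≤ x + y
  +-nonNeg 0≤x 0≤y = O.trans (O.reflexive (R.sym (R.+-identityˡ 0#))) (+-mono-≤ 0≤x 0≤y)

  x≤x+y : ∀ {x y} → 0# ≤ y → x ≤ x + y
  x≤x+y {x} {y} 0≤y = begin
    x      ≈⟨ R.+-identityʳ x ⟨
    x + 0# ≤⟨ +-mono-≤ O.refl 0≤y ⟩
    x + y  ∎

  x+y-y≈x : ∀ x y → (x + y) - y ≈ x
  x+y-y≈x x y = begin-equality
    (x + y) - y   ≈⟨ R.+-assoc x y (- y) ⟩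
    x + (y - y)   ≈⟨ R.+-congˡ (R.-‿inverseʳ y) ⟩
    x + 0#        ≈⟨ R.+-identityʳ x ⟩
    x             ∎

  x-y+y≈x : ∀ x y → (x - y) + y ≈ x
  x-y+y≈x x y = begin-equality
    (x - y) + y     ≈⟨ R.+-assoc x (- y) y ⟩
    x + (- y + y)   ≈⟨ R.+-congˡ (R.-‿inverseˡ y) ⟩
    x + 0#          ≈⟨ R.+-identityʳ x ⟩
    x               ∎

  +-cancelʳ-≤ : ∀ z {x y} → x + z ≤ y + z → x ≤ y
  +-cancelʳ-≤ z {x} {y} h = begin
    x           ≈⟨ x+y-y≈x x z ⟨
    (x + z) - z ≤⟨ +-monoˡ-≤ (- z) h ⟩
    (y + z) - z ≈⟨ x+y-y≈x y z ⟩
    y           ∎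

  x≤y⇒0≤y-x : ∀ {x y} → x ≤ y → 0# ≤ y - x
  x≤y⇒0≤y-x {x} {y} x≤y = O.trans (O.reflexive (R.sym (R.-‿inverseʳ x))) (+-monoˡ-≤ (- x) x≤y)

  x≤0⇒0≤-x : ∀ {x} → x ≤ 0# → 0# ≤ - x
  x≤0⇒0≤-x {x} x≤0 = O.trans (x≤y⇒0≤y-x x≤0) (O.reflexive (R.+-identityˡ (- x)))

  *-monoˡ-≤ : ∀ {z x y} → 0# ≤ z → x ≤ y → z * x ≤ z * y
  *-monoˡ-≤ {z} {x} {y} 0≤z x≤y = begin
    z * x                 ≈⟨ R.+-identityˡ _ ⟨
    0# + z * x            ≤⟨ +-monoˡ-≤ _ (*-nonNeg 0≤z (x≤y⇒0≤y-x x≤y)) ⟩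
    z * (y - x) + z * x   ≈⟨ R.distribˡ z (y - x) x ⟨
    z * ((y - x) + x)     ≈⟨ R.*-congˡ (x-y+y≈x y x) ⟩
    z * y                 ∎

  *-monoʳ-≤ : ∀ {z x y} → 0# ≤ z → x ≤ y → x * z ≤ y * z
  *-monoʳ-≤ {z} {x} {y} 0≤z x≤y = begin
    x * z ≈⟨ R.*-comm x z ⟩
    z * x ≤⟨ *-monoˡ-≤ 0≤z x≤y ⟩
    z * y ≈⟨ R.*-comm z y ⟩
    y * z ∎

  *-mono-≤ : ∀ {x y u v} → 0# ≤ x → 0# ≤ v → x ≤ y → u ≤ v → x * u ≤ y * v
  *-mono-≤ 0≤x 0≤v x≤y u≤v = O.trans (*-monoˡ-≤ 0≤x u≤v) (*-monoʳ-≤ 0≤v x≤y)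

  -- If 1 ≤ 0, then -1 is non-negative and so is its square, which is 1.
  0≤1 : 0# ≤ 1#
  0≤1 with O.total 0# 1#
  ... | inj₁ h = h
  ... | inj₂ h = begin
    0#            ≤⟨ *-nonNeg 0≤-1 0≤-1 ⟩
    - 1# * - 1#   ≈⟨ -‿distribʳ-* (- 1#) 1# ⟨
    - (- 1# * 1#) ≈⟨ R.-‿cong (R.*-identityʳ (- 1#)) ⟩
    - (- 1#)      ≈⟨ -‿involutive 1# ⟩
    1#            ∎
    where 0≤-1 = x≤0⇒0≤-x h

  0<1 : 0# < 1#
  0<1 = 0≤1 , 0≉1

  ≰⇒≥ : ∀ {x y} → ¬ x ≤ y → y ≤ x
  ≰⇒≥ {x} {y} h with O.total x y
  ... | inj₁ x≤y = ⊥-elim (h x≤y)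
  ... | inj₂ y≤x = y≤x

  *-inverseˡ : ∀ {x} → 0# < x → x ⁻¹ * x ≈ 1#
  *-inverseˡ {x} (_ , x≉0) = R.trans (R.*-comm _ x) (*-inverseʳ x (λ e → x≉0 (R.sym e)))

  -- A non-positive inverse would make the product of x with its inverse, which is 1, at most 0.
  ⁻¹-nonNeg : ∀ {x} → 0# < x → 0# ≤ x ⁻¹
  ⁻¹-nonNeg {x} 0<x with O.total 0# (x ⁻¹)
  ... | inj₁ h = h
  ... | inj₂ h = ⊥-elim (0≉1 (O.antisym 0≤1 (begin
    1#          ≈⟨ *-inverseˡ 0<x ⟨
    x ⁻¹ * x    ≤⟨ *-monoʳ-≤ (proj₁ 0<x) h ⟩
    0# * x      ≈⟨ R.zeroˡ x ⟩
    0#          ∎)))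

  *-cancelˡ-≤ : ∀ {z x y} → 0# < z → z * x ≤ z * y → x ≤ y
  *-cancelˡ-≤ {z} {x} {y} 0<z h = begin
    x               ≈⟨ undo x ⟨
    z ⁻¹ * (z * x)  ≤⟨ *-monoˡ-≤ (⁻¹-nonNeg 0<z) h ⟩
    z ⁻¹ * (z * y)  ≈⟨ undo y ⟩
    y               ∎
    where
    undo : ∀ u → z ⁻¹ * (z * u) ≈ u
    undo u = begin-equality
      z ⁻¹ * (z * u) ≈⟨ R.*-assoc _ z u ⟨
      (z ⁻¹ * z) * u ≈⟨ R.*-congʳ (*-inverseˡ 0<z) ⟩
      1# * u         ≈⟨ R.*-identityˡ u ⟩
      u              ∎

  <-≤-trans : ∀ {x y z} → x < y → y ≤ z → x < z
  <-≤-trans (x≤y , x≉y) y≤z =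
    O.trans x≤y y≤z , λ x≈z → x≉y (O.antisym x≤y (O.trans y≤z (O.reflexive (R.sym x≈z))))

  x<y⇒0<y-x : ∀ {x y} → x < y → 0# < y - x
  x<y⇒0<y-x {x} {y} (x≤y , x≉y) = x≤y⇒0≤y-x x≤y , λ e → x≉y (begin-equality
    x            ≈⟨ R.+-identityˡ x ⟨
    0# + x       ≈⟨ R.+-congʳ e ⟩
    (y - x) + x  ≈⟨ x-y+y≈x y x ⟩
    y            ∎)

  -- Natural numbers, integer parts and powers.

  fromℕ-nonNeg : ∀ k → 0# ≤ fromℕ k
  fromℕ-nonNeg zero    = O.refl
  fromℕ-nonNeg (suc k) = +-nonNeg 0≤1 (fromℕ-nonNeg k)

  fromℕ-mono-≤ : ∀ {j k} → j ℕ.≤ k → fromℕ j ≤ fromℕ k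
  fromℕ-mono-≤ {k = k} ℕ.z≤n = fromℕ-nonNeg k
  fromℕ-mono-≤ (ℕ.s≤s h) = +-mono-≤ O.refl (fromℕ-mono-≤ h)

  -- The search descends from an Archimedean bound until it meets an integer that is at most x. The
  -- upper bound is not strict, so at a positive integer x the witness may be x - 1.
  floor : ∀ {x} → 0# ≤ x → ∃[ k ] fromℕ k ≤ x × x ≤ fromℕ (suc k)
  floor {x} 0≤x = let K , x≤K = archimedean x in search K x≤K
    where
    search : ∀ K → x ≤ fromℕ K → ∃[ k ] fromℕ k ≤ x × x ≤ fromℕ (suc k)
    search zero    x≤0 = 0 , 0≤x , O.trans x≤0 (fromℕ-nonNeg 1)
    search (suc K) x≤K with fromℕ K ≤? x
    ... | yes K≤x = K , K≤x , x≤K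
    ... | no  K≰x = search K (≰⇒≥ K≰x)

  infixr 8 _^_
  _^_ : Carrier → ℕ → Carrier
  x ^ zero  = 1#
  x ^ suc k = x * x ^ k

  ^-nonNeg : ∀ {x} k → 0# ≤ x → 0# ≤ x ^ k
  ^-nonNeg zero    0≤x = 0≤1
  ^-nonNeg (suc k) 0≤x = *-nonNeg 0≤x (^-nonNeg k 0≤x)

  ^-mono-≤ : ∀ {x y} k → 0# ≤ x → x ≤ y → x ^ k ≤ y ^ k
  ^-mono-≤ zero    0≤x x≤y = O.refl
  ^-mono-≤ (suc k) 0≤x x≤y =
    *-mono-≤ 0≤x (^-nonNeg k (O.trans 0≤x x≤y)) x≤y (^-mono-≤ k 0≤x x≤y)

  1^k≈1 : ∀ k → 1# ^ k ≈ 1#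
  1^k≈1 zero    = R.refl
  1^k≈1 (suc k) = R.trans (R.*-identityˡ _) (1^k≈1 k)

  ^-distrib-* : ∀ x y k → (x * y) ^ k ≈ x ^ k * y ^ k
  ^-distrib-* x y zero    = R.sym (R.*-identityˡ 1#)
  ^-distrib-* x y (suc k) = R.trans (R.*-congˡ (^-distrib-* x y k))
    (solve 4 (λ a b c d → (a :* b) :* (c :* d) := (a :* c) :* (b :* d)) R.refl x y (x ^ k) (y ^ k))

  -- For x ≥ 1 the remaining k factors have product at least 1, so x is at most its own power.
  ^-≤1⇒≤1 : ∀ {x} k → 0# ≤ x → x ^ suc k ≤ 1# → x ≤ 1#
  ^-≤1⇒≤1 {x} k 0≤x h with O.total x 1#
  ... | inj₁ x≤1 = x≤1
  ... | inj₂ 1≤x = begin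
    x             ≈⟨ R.*-identityʳ x ⟨
    x * 1#        ≈⟨ R.*-congˡ (1^k≈1 k) ⟨
    x * 1# ^ k    ≤⟨ *-monoˡ-≤ 0≤x (^-mono-≤ k 0≤1 1≤x) ⟩
    x * x ^ k     ≤⟨ h ⟩
    1#            ∎

  -- The exponential to base 2, compared with 1 - d.

  2^-cong : ∀ {x y} → x ≈ y → 2^ x ≈ 2^ y
  2^-cong e = O.antisym (2^-mono-≤ (O.reflexive e)) (2^-mono-≤ (O.reflexive (R.sym e)))

  0<2 : 0# < 1# + 1#
  0<2 = <-≤-trans 0<1 (x≤x+y 0≤1)

  -- The factor 2 = `2^ 1#` cancels from both sides of the homomorphism law at 1 + 0.
  2^0≈1 : 2^ 0# ≈ 1#
  2^0≈1 = O.antisym (*-cancelˡ-≤ 0<2 (O.reflexive e)) (*-cancelˡ-≤ 0<2 (O.reflexive (R.sym e)))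
    where
    e : (1# + 1#) * 2^ 0# ≈ (1# + 1#) * 1#
    e = begin-equality
      (1# + 1#) * 2^ 0# ≈⟨ R.*-congʳ 2^-one ⟨
      2^ 1# * 2^ 0#     ≈⟨ 2^-homo 1# 0# ⟨
      2^ (1# + 0#)      ≈⟨ 2^-cong (R.+-identityʳ 1#) ⟩
      2^ 1#             ≈⟨ 2^-one ⟩
      1# + 1#           ≈⟨ R.*-identityʳ _ ⟨
      (1# + 1#) * 1#    ∎

  2^-inverseʳ : ∀ x → 2^ x * 2^ (- x) ≈ 1#
  2^-inverseʳ x = begin-equality
    2^ x * 2^ (- x) ≈⟨ 2^-homo x (- x) ⟨
    2^ (x - x)      ≈⟨ 2^-cong (R.-‿inverseʳ x) ⟩
    2^ 0#           ≈⟨ 2^0≈1 ⟩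
    1#              ∎

  -- For x ≤ 0 the value is inverse to `2^ (- x)`, which is at least 1.
  2^-nonNeg : ∀ x → 0# ≤ 2^ x
  2^-nonNeg x with O.total 0# x
  ... | inj₁ 0≤x = O.trans 0≤1 (O.trans (O.reflexive (R.sym 2^0≈1)) (2^-mono-≤ 0≤x))
  ... | inj₂ x≤0 = *-cancelˡ-≤ 0<2^-x (begin
    2^ (- x) * 0#    ≈⟨ R.zeroʳ _ ⟩
    0#               ≤⟨ 0≤1 ⟩
    1#               ≈⟨ 2^-inverseʳ x ⟨
    2^ x * 2^ (- x)  ≈⟨ R.*-comm _ _ ⟩
    2^ (- x) * 2^ x  ∎)
    where
    0<2^-x : 0# < 2^ (- x)
    0<2^-x = <-≤-trans 0<1 (O.trans (O.reflexive (R.sym 2^0≈1)) (2^-mono-≤ (x≤0⇒0≤-x x≤0)))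

  2^-fromℕ-* : ∀ k x → 2^ (fromℕ k * x) ≈ (2^ x) ^ k
  2^-fromℕ-* zero    x = R.trans (2^-cong (R.zeroˡ x)) 2^0≈1
  2^-fromℕ-* (suc k) x = begin-equality
    2^ ((1# + fromℕ k) * x)    ≈⟨ 2^-cong (solve 2 (λ a b → (con 1 :+ a) :* b := b :+ a :* b) R.refl (fromℕ k) x) ⟩
    2^ (x + fromℕ k * x)       ≈⟨ 2^-homo x _ ⟩
    2^ x * 2^ (fromℕ k * x)    ≈⟨ R.*-congˡ (2^-fromℕ-* k x) ⟩
    2^ x * (2^ x) ^ k          ∎

  -- A k with k x ≥ 1 gives (2ˣ)ᵏ ≥ 2, so 2ˣ = 1 is impossible for x > 0.
  2^x≤1⇒x≤0 : ∀ {x} → 2^ x ≤ 1# → x ≤ 0#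
  2^x≤1⇒x≤0 {x} h with x ≤? 0#
  ... | yes x≤0 = x≤0
  ... | no  x≰0 = ⊥-elim (proj₂ (<-≤-trans (x≤x+y 0≤1 , 1≉2) 2≤1) R.refl)
    where
    1≉2 : ¬ 1# ≈ 1# + 1#
    1≉2 e = 0≉1 (O.antisym 0≤1 (+-cancelʳ-≤ 1# (O.reflexive
      (R.trans (R.sym e) (R.sym (R.+-identityˡ 1#))))))
    0<x : 0# < x
    0<x = ≰⇒≥ x≰0 , λ e → x≰0 (O.reflexive (R.sym e))
    K = archimedean (x ⁻¹)
    k = proj₁ K
    1≤kx : 1# ≤ fromℕ k * x
    1≤kx = begin
      1#            ≈⟨ *-inverseˡ 0<x ⟨
      x ⁻¹ * x      ≤⟨ *-monoʳ-≤ (proj₁ 0<x) (proj₂ K) ⟩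
      fromℕ k * x   ∎
    2≤1 : 1# + 1# ≤ 1#
    2≤1 = begin
      1# + 1#           ≈⟨ 2^-one ⟨
      2^ 1#             ≤⟨ 2^-mono-≤ 1≤kx ⟩
      2^ (fromℕ k * x)  ≈⟨ 2^-fromℕ-* k x ⟩
      (2^ x) ^ k        ≤⟨ ^-mono-≤ k (2^-nonNeg x) h ⟩
      1# ^ k            ≈⟨ 1^k≈1 k ⟩
      1#                ∎

  -- The preceding lemma at -x. It gives the sign of `T₀`, whose logarithms are known only through
  -- their exponentials.
  1≤2^x⇒0≤x : ∀ {x} → 1# ≤ 2^ x → 0# ≤ x
  1≤2^x⇒0≤x {x} h = begin
    0#       ≤⟨ x≤0⇒0≤-x (2^x≤1⇒x≤0 2^-x≤1) ⟩
    - (- x)  ≈⟨ -‿involutive x ⟩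
    x        ∎
    where
    2^-x≤1 : 2^ (- x) ≤ 1#
    2^-x≤1 = begin
      2^ (- x)         ≈⟨ R.*-identityˡ _ ⟨
      1# * 2^ (- x)    ≤⟨ *-monoʳ-≤ (2^-nonNeg _) h ⟩
      2^ x * 2^ (- x)  ≈⟨ 2^-inverseʳ x ⟩
      1#               ∎

  -- The first two terms of the binomial expansion of (y + d)^(k+1).
  bernoulli : ∀ {y d} k → 0# ≤ y → 0# ≤ d → y + d ≈ 1# → y ^ k * (y + fromℕ (suc k) * d) ≤ 1#
  bernoulli {y} {d} zero 0≤y 0≤d y+d≈1 = O.reflexive (R.trans
    (solve 2 (λ y d → con 1 :* (y :+ (con 1 :+ con 0) :* d) := y :+ d) R.refl y d) y+d≈1)
  bernoulli {y} {d} (suc k) 0≤y 0≤d y+d≈1 = begin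
    (y * y ^ k) * (y + (1# + fromℕ (suc k)) * d)
      ≈⟨ solve 4 (λ y p f d → (y :* p) :* (y :+ (con 1 :+ f) :* d)
                              := y :* (p :* (y :+ f :* d)) :+ (y :* p) :* d)
               R.refl y (y ^ k) (fromℕ (suc k)) d ⟩
    y * (y ^ k * (y + fromℕ (suc k) * d)) + y ^ suc k * d
      ≤⟨ +-mono-≤ (*-monoˡ-≤ 0≤y (bernoulli k 0≤y 0≤d y+d≈1)) (*-monoʳ-≤ 0≤d y^k≤1) ⟩
    y * 1# + 1# * d
      ≈⟨ R.+-cong (R.*-identityʳ y) (R.*-identityˡ d) ⟩
    y + d
      ≈⟨ y+d≈1 ⟩
    1# ∎
    where
    y≤1 : y ≤ 1#
    y≤1 = O.trans (x≤x+y 0≤d) (O.reflexive y+d≈1)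
    y^k≤1 : y ^ suc k ≤ 1#
    y^k≤1 = O.trans (^-mono-≤ (suc k) 0≤y y≤1) (O.reflexive (1^k≈1 (suc k)))

  -- With L = ⌊1/d⌋ we have (L + 1) d ≥ 1, so Bernoulli gives 2 yᴸ ≤ 1 and
  -- (2ᵈ y)ᴸ ≤ 2 yᴸ ≤ 1.
  2^d*y≤1 : ∀ {y d} → 0# ≤ y → 0# < d → y + d ≈ 1# → 2^ d * y ≤ 1#
  2^d*y≤1 {y} {d} 0≤y 0<d y+d≈1 = atFloor (floor (⁻¹-nonNeg 0<d))
    where
    0≤d = proj₁ 0<d
    d≤1 : d ≤ 1#
    d≤1 = begin
      d     ≤⟨ x≤x+y 0≤y ⟩
      d + y ≈⟨ R.+-comm d y ⟩
      y + d ≈⟨ y+d≈1 ⟩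
      1#    ∎
    bound : ∀ k → fromℕ (suc k) * d ≤ 1# → 1# ≤ fromℕ (suc (suc k)) * d → 2^ d * y ≤ 1#
    bound k Ld≤1 1≤[L+1]d = ^-≤1⇒≤1 k (*-nonNeg (2^-nonNeg d) 0≤y) (begin
      (2^ d * y) ^ suc k                ≈⟨ ^-distrib-* (2^ d) y (suc k) ⟩
      (2^ d) ^ suc k * y ^ suc k        ≈⟨ R.*-congʳ (2^-fromℕ-* (suc k) d) ⟨
      2^ (fromℕ (suc k) * d) * y ^ suc k ≤⟨ *-monoʳ-≤ (^-nonNeg (suc k) 0≤y) (2^-mono-≤ Ld≤1) ⟩
      2^ 1# * y ^ suc k                 ≈⟨ R.*-congʳ 2^-one ⟩
      (1# + 1#) * y ^ suc k             ≈⟨ solve 2 (λ y p → (con 1 :+ con 1) :* (y :* p) := p :* (y :+ y)) R.refl y (y ^ k) ⟩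
      y ^ k * (y + y)                   ≤⟨ *-monoˡ-≤ (^-nonNeg k 0≤y) (+-mono-≤ O.refl y≤Ld) ⟩
      y ^ k * (y + fromℕ (suc k) * d)   ≤⟨ bernoulli k 0≤y 0≤d y+d≈1 ⟩
      1#                                ∎)
      where
      -- Cancelling d from y + d = 1 ≤ (L + 1) d. Bernoulli's factor y + L d is therefore at least 2
      -- y.
      y≤Ld : y ≤ fromℕ (suc k) * d
      y≤Ld = +-cancelʳ-≤ d (begin
        y + d                        ≈⟨ y+d≈1 ⟩
        1#                           ≤⟨ 1≤[L+1]d ⟩
        (1# + fromℕ (suc k)) * d     ≈⟨ solve 2 (λ a b → (con 1 :+ a) :* b := a :* b :+ b) R.refl (fromℕ (suc k)) d ⟩
        fromℕ (suc k) * d + d        ∎)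
    times-d-≤1 : ∀ {x} → x ≤ d ⁻¹ → x * d ≤ 1#
    times-d-≤1 h = O.trans (*-monoʳ-≤ 0≤d h) (O.reflexive (*-inverseˡ 0<d))
    1≤times-d : ∀ {x} → d ⁻¹ ≤ x → 1# ≤ x * d
    1≤times-d h = O.trans (O.reflexive (R.sym (*-inverseˡ 0<d))) (*-monoʳ-≤ 0≤d h)
    atFloor : ∃[ k ] fromℕ k ≤ d ⁻¹ × d ⁻¹ ≤ fromℕ (suc k) → 2^ d * y ≤ 1#
    atFloor (suc k , lo , hi) = bound k (times-d-≤1 lo) (1≤times-d hi)
    -- Only d = 1 leads here, through the weak upper bound of `floor`. Since `bound` needs a
    -- positive L, take L = 1: d ≤ 1 gives the first condition, and 1 ≤ d ≤ 2 d the second.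
    atFloor (zero  , lo , hi) = bound zero
      (O.trans (O.reflexive (R.trans (R.*-congʳ (R.+-identityʳ 1#)) (R.*-identityˡ d))) d≤1)
      (O.trans (1≤times-d hi) (*-monoʳ-≤ 0≤d (fromℕ-mono-≤ {1} {2} (ℕ.s≤s ℕ.z≤n))))

-- Finite sums and products with Iverson brackets.

module Sums {c ℓ₁ ℓ₂} (ℝ : Reals c ℓ₁ ℓ₂) where
  open Reals ℝ
  open OrderedField ℝ
  open PosetReasoning (TotalOrder.poset totalOrder)

  -- The Iverson bracket. It turns sums over filtered lists into sums over fixed lists, which can be
  -- exchanged and factored.
  ⟦_⟧ : Bool → Carrier
  ⟦ false ⟧ = 0#
  ⟦ true  ⟧ = 1#

  ⟦⟧-nonNeg : ∀ b → 0# ≤ ⟦ b ⟧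
  ⟦⟧-nonNeg false = O.refl
  ⟦⟧-nonNeg true  = 0≤1

  ⟦⟧-≤1 : ∀ b → ⟦ b ⟧ ≤ 1#
  ⟦⟧-≤1 false = 0≤1
  ⟦⟧-≤1 true  = O.refl

  ⟦⟧*-≤ : ∀ b {x} → 0# ≤ x → ⟦ b ⟧ * x ≤ x
  ⟦⟧*-≤ b 0≤x = O.trans (*-monoʳ-≤ 0≤x (⟦⟧-≤1 b)) (O.reflexive (R.*-identityˡ _))

  ⟦not∨⟧ : ∀ a b → ⟦ not (a ∨ b) ⟧ ≈ ⟦ not a ⟧ * ⟦ not b ⟧
  ⟦not∨⟧ false b = R.sym (R.*-identityˡ _)
  ⟦not∨⟧ true  b = R.sym (R.zeroˡ _)

  -- The sign of x matters only where P holds; transition probabilities `ρ i σ τ` are constrained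
  -- only for σ in `flaw i`.
  ⟦does⟧*-nonNeg : ∀ {p} {P : Set p} (d : Dec P) {x} → (P → 0# ≤ x) → 0# ≤ ⟦ does d ⟧ * x
  ⟦does⟧*-nonNeg (yes p) h = O.trans (h p) (O.reflexive (R.sym (R.*-identityˡ _)))
  ⟦does⟧*-nonNeg (no  _) h = O.reflexive (R.sym (R.zeroˡ _))

  module _ {a} {A : Set a} where

    ∑-cong : ∀ (xs : List A) {f g : A → Carrier} → (∀ x → f x ≈ g x) → ∑ xs f ≈ ∑ xs g
    ∑-cong []       h = R.refl
    ∑-cong (x ∷ xs) h = R.+-cong (h x) (∑-cong xs h)

    ∑-mono-≤ : ∀ (xs : List A) {f g : A → Carrier} → (∀ x → f x ≤ g x) → ∑ xs f ≤ ∑ xs g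
    ∑-mono-≤ []       h = O.refl
    ∑-mono-≤ (x ∷ xs) h = +-mono-≤ (h x) (∑-mono-≤ xs h)

    ∑-zero : ∀ (xs : List A) {f : A → Carrier} → (∀ x → f x ≈ 0#) → ∑ xs f ≈ 0#
    ∑-zero []       h = R.refl
    ∑-zero (x ∷ xs) h = R.trans (R.+-cong (h x) (∑-zero xs h)) (R.+-identityˡ 0#)

    ∑-nonNeg : ∀ (xs : List A) {f : A → Carrier} → (∀ x → 0# ≤ f x) → 0# ≤ ∑ xs f
    ∑-nonNeg []       h = O.refl
    ∑-nonNeg (x ∷ xs) h = +-nonNeg (h x) (∑-nonNeg xs h)

    ∑-distrib-+ : ∀ (xs : List A) (f g : A → Carrier) → ∑ xs (λ x → f x + g x) ≈ ∑ xs f + ∑ xs g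
    ∑-distrib-+ []       f g = R.sym (R.+-identityˡ 0#)
    ∑-distrib-+ (x ∷ xs) f g = R.trans (R.+-congˡ (∑-distrib-+ xs f g))
      (solve 4 (λ a b c d → (a :+ b) :+ (c :+ d) := (a :+ c) :+ (b :+ d)) R.refl (f x) (g x) (∑ xs f) (∑ xs g))

    *-distribˡ-∑ : ∀ y (xs : List A) (f : A → Carrier) → y * ∑ xs f ≈ ∑ xs (λ x → y * f x)
    *-distribˡ-∑ y []       f = R.zeroʳ y
    *-distribˡ-∑ y (x ∷ xs) f = R.trans (R.distribˡ y _ _) (R.+-congˡ (*-distribˡ-∑ y xs f))

    *-distribʳ-∑ : ∀ y (xs : List A) (f : A → Carrier) → ∑ xs f * y ≈ ∑ xs (λ x → f x * y)
    *-distribʳ-∑ y []       f = R.zeroˡ y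
    *-distribʳ-∑ y (x ∷ xs) f = R.trans (R.distribʳ y _ _) (R.+-congˡ (*-distribʳ-∑ y xs f))

    ∑-++ : ∀ (xs ys : List A) (f : A → Carrier) → ∑ (xs ++ ys) f ≈ ∑ xs f + ∑ ys f
    ∑-++ []       ys f = R.sym (R.+-identityˡ _)
    ∑-++ (x ∷ xs) ys f = R.trans (R.+-congˡ (∑-++ xs ys f)) (R.sym (R.+-assoc _ _ _))

    ∑-map : ∀ {b} {B : Set b} (g : B → A) ys (f : A → Carrier) → ∑ (map g ys) f ≡ ∑ ys (f ∘ g)
    ∑-map g []       f = ≡.refl
    ∑-map g (y ∷ ys) f = ≡.cong (f (g y) +_) (∑-map g ys f)

    ∏-map : ∀ {b} {B : Set b} (g : B → A) ys (f : A → Carrier) → ∏ (map g ys) f ≡ ∏ ys (f ∘ g)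
    ∏-map g []       f = ≡.refl
    ∏-map g (y ∷ ys) f = ≡.cong (f (g y) *_) (∏-map g ys f)

    ∑-member-≤ : ∀ {xs : List A} {x} (f : A → Carrier) → (∀ y → 0# ≤ f y) → x ∈ˡ xs → f x ≤ ∑ xs f
    ∑-member-≤ {y ∷ ys} f 0≤f (here ≡.refl) = x≤x+y (∑-nonNeg ys 0≤f)
    ∑-member-≤ {y ∷ ys} {x} f 0≤f (there x∈ys) = begin
      f x          ≤⟨ ∑-member-≤ f 0≤f x∈ys ⟩
      ∑ ys f       ≤⟨ x≤x+y (0≤f y) ⟩
      ∑ ys f + f y ≈⟨ R.+-comm _ _ ⟩
      f y + ∑ ys f ∎

    module _ {p} {P : Pred A p} (P? : Decidable P) where

      ∑-filter : ∀ xs (f : A → Carrier) → ∑ (filter P? xs) f ≈ ∑ xs (λ x → ⟦ does (P? x) ⟧ * f x)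
      ∑-filter []       f = R.refl
      ∑-filter (x ∷ xs) f with does (P? x)
      ... | false = R.trans (∑-filter xs f) (R.sym (R.trans (R.+-congʳ (R.zeroˡ _)) (R.+-identityˡ _)))
      ... | true  = R.+-cong (R.sym (R.*-identityˡ _)) (∑-filter xs f)

      ∏-filter : ∀ xs (f : A → Carrier) → ∏ (filter P? xs) f ≈ ∏ xs (λ x → if does (P? x) then f x else 1#)
      ∏-filter []       f = R.refl
      ∏-filter (x ∷ xs) f with does (P? x)
      ... | false = R.trans (∏-filter xs f) (R.sym (R.*-identityˡ _))
      ... | true  = R.*-congˡ (∏-filter xs f)

      ∑-⟦⟧ : ∀ xs → ∑ xs (λ x → ⟦ does (P? x) ⟧) ≈ fromℕ (length (filter P? xs))
      ∑-⟦⟧ []       = R.refl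
      ∑-⟦⟧ (x ∷ xs) with does (P? x)
      ... | false = R.trans (R.+-identityˡ _) (∑-⟦⟧ xs)
      ... | true  = R.+-congˡ (∑-⟦⟧ xs)

      ∑-filter-complement : ∀ xs (f : A → Carrier) →
        ∑ (filter P? xs) f + ∑ xs (λ x → ⟦ not (does (P? x)) ⟧ * f x) ≈ ∑ xs f
      ∑-filter-complement xs f = begin-equality
        ∑ (filter P? xs) f + ∑ xs (λ x → ⟦ not (does (P? x)) ⟧ * f x)
          ≈⟨ R.+-congʳ (∑-filter xs f) ⟩
        ∑ xs (λ x → ⟦ does (P? x) ⟧ * f x) + ∑ xs (λ x → ⟦ not (does (P? x)) ⟧ * f x)
          ≈⟨ ∑-distrib-+ xs _ _ ⟨
        ∑ xs (λ x → ⟦ does (P? x) ⟧ * f x + ⟦ not (does (P? x)) ⟧ * f x)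
          ≈⟨ ∑-cong xs (λ x → split (does (P? x)) (f x)) ⟩
        ∑ xs f ∎
        where
        split : ∀ b y → ⟦ b ⟧ * y + ⟦ not b ⟧ * y ≈ y
        split false = solve 1 (λ y → con 0 :* y :+ con 1 :* y := y) R.refl
        split true  = solve 1 (λ y → con 1 :* y :+ con 0 :* y := y) R.refl

    ∏-cong : ∀ (xs : List A) {f g : A → Carrier} → (∀ x → f x ≈ g x) → ∏ xs f ≈ ∏ xs g
    ∏-cong []       h = R.refl
    ∏-cong (x ∷ xs) h = R.*-cong (h x) (∏-cong xs h)

    ∏-distrib-* : ∀ (xs : List A) (f g : A → Carrier) → ∏ xs (λ x → f x * g x) ≈ ∏ xs f * ∏ xs g
    ∏-distrib-* []       f g = R.sym (R.*-identityˡ 1#)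
    ∏-distrib-* (x ∷ xs) f g = R.trans (R.*-congˡ (∏-distrib-* xs f g))
      (solve 4 (λ a b c d → (a :* b) :* (c :* d) := (a :* c) :* (b :* d)) R.refl (f x) (g x) (∏ xs f) (∏ xs g))

    ∏-nonNeg : ∀ (xs : List A) {f : A → Carrier} → (∀ x → 0# ≤ f x) → 0# ≤ ∏ xs f
    ∏-nonNeg []       h = 0≤1
    ∏-nonNeg (x ∷ xs) h = *-nonNeg (h x) (∏-nonNeg xs h)

    ∏-mono-≤ : ∀ (xs : List A) {f g : A → Carrier} → (∀ x → 0# ≤ f x) → (∀ x → f x ≤ g x) → ∏ xs f ≤ ∏ xs g
    ∏-mono-≤ []       0≤f h = O.refl
    ∏-mono-≤ (x ∷ xs) 0≤f h =
      *-mono-≤ (0≤f x) (∏-nonNeg xs (λ y → O.trans (0≤f y) (h y))) (h x) (∏-mono-≤ xs 0≤f h)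

    1≤∏ : ∀ (xs : List A) {f : A → Carrier} → (∀ x → 1# ≤ f x) → 1# ≤ ∏ xs f
    1≤∏ []       h = O.refl
    1≤∏ (x ∷ xs) {f} h = begin
      1#            ≈⟨ R.*-identityˡ 1# ⟨
      1# * 1#       ≤⟨ *-mono-≤ 0≤1 (O.trans 0≤1 (1≤∏ xs h)) (h x) (1≤∏ xs h) ⟩
      f x * ∏ xs f  ∎

    maximum-nonNeg : ∀ (xs : List A) (f : A → Carrier) → 0# ≤ maximum xs f
    maximum-nonNeg xs f = Extrema.⊥≤max totalOrder 0# (map f xs)

    ≤-maximum : ∀ {xs : List A} {x} (f : A → Carrier) → x ∈ˡ xs → f x ≤ maximum xs f
    ≤-maximum f x∈xs = All.lookup (Extrema.xs≤max totalOrder 0# _) (∈-map⁺ f x∈xs)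

  ∑-swap : ∀ {a b} {A : Set a} {B : Set b} (xs : List A) (ys : List B) (f : A → B → Carrier) →
           ∑ xs (λ x → ∑ ys (f x)) ≈ ∑ ys (λ y → ∑ xs (λ x → f x y))
  ∑-swap []       ys f = R.sym (∑-zero ys (λ _ → R.refl))
  ∑-swap (x ∷ xs) ys f = R.trans (R.+-congˡ (∑-swap xs ys f)) (R.sym (∑-distrib-+ ys _ _))

  ∑-cartesianProductWith :
    ∀ {a b c} {A : Set a} {B : Set b} {C : Set c} (_∙_ : A → B → C) xs ys (f : C → Carrier) →
    ∑ (cartesianProductWith _∙_ xs ys) f ≈ ∑ xs (λ x → ∑ ys (λ y → f (x ∙ y)))
  ∑-cartesianProductWith _∙_ []       ys f = R.refl
  ∑-cartesianProductWith _∙_ (x ∷ xs) ys f = R.trans (∑-++ (map (x ∙_) ys) _ f)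
    (R.+-cong (R.reflexive (∑-map (x ∙_) ys f)) (∑-cartesianProductWith _∙_ xs ys f))

  ∑-allFin-suc : ∀ {k} (f : Fin (suc k) → Carrier) →
                 ∑ (allFin (suc k)) f ≡ f Fin.zero + ∑ (allFin k) (f ∘ Fin.suc)
  ∑-allFin-suc {k} f = ≡.cong (f Fin.zero +_)
    (≡.trans (≡.cong (λ xs → ∑ xs f) (≡.sym (map-tabulate (λ x → x) Fin.suc))) (∑-map Fin.suc (allFin k) f))

  -- A stopped walk stays where it is; this gives that step total mass 1.
  ∑-dirac : ∀ {k} (i : Fin k) → ∑ (allFin k) (λ j → if does (j Finₚ.≟ i) then 1# else 0#) ≈ 1#
  ∑-dirac {suc k} Fin.zero = R.trans (R.reflexive (∑-allFin-suc {k} _))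
    (R.trans (R.+-congˡ (∑-zero (allFin k) (λ _ → R.refl))) (R.+-identityʳ 1#))
  ∑-dirac {suc k} (Fin.suc i) = R.trans (R.reflexive (∑-allFin-suc {k} _))
    (R.trans (R.+-identityˡ _) (∑-dirac i))

  ∏-allFin-suc : ∀ {m} (f : Fin (suc m) → Carrier) →
                 ∏ (allFin (suc m)) f ≡ f Fin.zero * ∏ (allFin m) (f ∘ Fin.suc)
  ∏-allFin-suc {m} f = ≡.cong (f Fin.zero *_)
    (≡.trans (≡.cong (λ xs → ∏ xs f) (≡.sym (map-tabulate (λ x → x) Fin.suc))) (∏-map Fin.suc (allFin m) f))

  -- Sums over subsets as products.

  does-∈? : ∀ {m} (j : Fin m) (S : Subset m) → does (j ∈? S) ≡ lookup S j
  does-∈? Fin.zero    (true  Vec.∷ S) = ≡.refl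
  does-∈? Fin.zero    (false Vec.∷ S) = ≡.refl
  does-∈? (Fin.suc j) (s Vec.∷ S)     = does-∈? j S

  -- Multiplying out the product means choosing 1 or `ψ j` for every j in R, which is the choice of
  -- a subset of R.
  subset-weight : ∀ {m} (ψ : Fin m → Carrier) (R : Subset m) →
    ∑ (subsetsOf R) (λ S → ∏ (elements S) ψ) ≈ ∏ (allFin m) (λ j → 1# + ⟦ lookup R j ⟧ * ψ j)
  subset-weight {m} ψ R = begin-equality
    ∑ (subsetsOf R) (λ S → ∏ (elements S) ψ)
      ≈⟨ ∑-filter (_⊆? R) (vectors bits m) _ ⟩
    ∑ (vectors bits m) (λ S → ⟦ does (S ⊆? R) ⟧ * ∏ (elements S) ψ)
      ≈⟨ ∑-cong (vectors bits m) (λ S → R.*-congˡ (R.trans (∏-filter (_∈? S) (allFin m) ψ)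
           (∏-cong (allFin m) (λ j → R.reflexive (≡.cong (λ b → if b then ψ j else 1#) (does-∈? j S)))))) ⟩
    ∑ (vectors bits m) (λ S → ⟦ does (S ⊆? R) ⟧ * select S ψ)
      ≈⟨ factorise ψ R ⟩
    ∏ (allFin m) (λ j → 1# + ⟦ lookup R j ⟧ * ψ j) ∎
    where
    bits : List Bool
    bits = true ∷ false ∷ []

    select : ∀ {k} → Subset k → (Fin k → Carrier) → Carrier
    select S ψ = ∏ (allFin _) (λ j → if lookup S j then ψ j else 1#)

    factorise : ∀ {k} (ψ : Fin k → Carrier) (R : Subset k) →
      ∑ (vectors bits k) (λ S → ⟦ does (S ⊆? R) ⟧ * select S ψ) ≈ ∏ (allFin k) (λ j → 1# + ⟦ lookup R j ⟧ * ψ j)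
    factorise {zero}  ψ Vec.[] = solve 0 (con 1 :* con 1 :+ con 0 := con 1) R.refl
    factorise {suc k} ψ (r Vec.∷ R) = begin-equality
      ∑ (vectors bits (suc k)) (λ S → ⟦ does (S ⊆? r Vec.∷ R) ⟧ * select S ψ)
        ≈⟨ ∑-cartesianProductWith Vec._∷_ bits (vectors bits k) _ ⟩
      ∑ (vectors bits k) (term true) + (∑ (vectors bits k) (term false) + 0#)
        ≈⟨ R.+-cong (factor true (λ S → ⊆?-true r S)) (R.trans (R.+-identityʳ _) (factor false (λ S → R.sym (R.*-identityˡ _)))) ⟩
      (⟦ r ⟧ * ψ Fin.zero) * ∑ (vectors bits k) rest + (1# * 1#) * ∑ (vectors bits k) rest
        ≈⟨ solve 2 (λ a s → a :* s :+ (con 1 :* con 1) :* s := (con 1 :+ a) :* s) R.refl _ _ ⟩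
      (1# + ⟦ r ⟧ * ψ Fin.zero) * ∑ (vectors bits k) rest
        ≈⟨ R.*-congˡ (factorise (ψ ∘ Fin.suc) R) ⟩
      (1# + ⟦ r ⟧ * ψ Fin.zero) * ∏ (allFin k) (λ j → 1# + ⟦ lookup R j ⟧ * ψ (Fin.suc j))
        ≈⟨ R.reflexive (∏-allFin-suc (λ j → 1# + ⟦ lookup (r Vec.∷ R) j ⟧ * ψ j)) ⟨
      ∏ (allFin (suc k)) (λ j → 1# + ⟦ lookup (r Vec.∷ R) j ⟧ * ψ j) ∎
      where
      term : Bool → Subset k → Carrier
      term s S = ⟦ does (s Vec.∷ S ⊆? r Vec.∷ R) ⟧ * select (s Vec.∷ S) ψ
      rest : Subset k → Carrier
      rest S = ⟦ does (S ⊆? R) ⟧ * select S (ψ ∘ Fin.suc)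
      -- A head bit `false` is compatible with every R, a head bit `true` only if R contains the
      -- head.
      allowed : Bool → Bool
      allowed true  = r
      allowed false = true
      ⊆?-true : ∀ r S → ⟦ does (true Vec.∷ S ⊆? r Vec.∷ R) ⟧ ≈ ⟦ r ⟧ * ⟦ does (S ⊆? R) ⟧
      ⊆?-true true  S = R.sym (R.*-identityˡ _)
      ⊆?-true false S = R.sym (R.zeroˡ _)
      factor : ∀ s → (∀ S → ⟦ does (s Vec.∷ S ⊆? r Vec.∷ R) ⟧ ≈ ⟦ allowed s ⟧ * ⟦ does (S ⊆? R) ⟧) →
        ∑ (vectors bits k) (term s) ≈ (⟦ allowed s ⟧ * (if s then ψ Fin.zero else 1#)) * ∑ (vectors bits k) rest
      factor s h = R.trans (∑-cong (vectors bits k) (λ S → R.trans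
        (R.*-cong (h S) (R.reflexive (∏-allFin-suc (λ j → if lookup (s Vec.∷ S) j then ψ j else 1#))))
        (solve 4 (λ a b c d → (a :* b) :* (c :* d) := (a :* c) :* (b :* d)) R.refl _ _ _ _)))
        (R.sym (*-distribˡ-∑ _ (vectors bits k) rest))

  -- Subsets grouped by their element of largest key.

  module _ {a} {A : Set a} (key : A → ℕ) (v : A → Carrier) (0≤v : ∀ x → 0# ≤ v x) where

    -- Factors are switched off by the bracket instead of being filtered out, so the list stays
    -- fixed while the threshold moves. With v supported on V and t = `key w`, this is w(V_{<w}) of
    -- the overview.
    ∏below : ℕ → List A → Carrier
    ∏below t xs = ∏ xs (λ x → 1# + ⟦ key x <ᵇ t ⟧ * v x)

    private
      0≤∏below : ∀ t xs → 0# ≤ ∏below t xs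
      0≤∏below t xs = ∏-nonNeg xs (λ x → +-nonNeg 0≤1 (*-nonNeg (⟦⟧-nonNeg (key x <ᵇ t)) (0≤v x)))

      -- The weight of the subsets whose element w of largest key comes from `xs` and has key at
      -- least t, the others coming from `ys`. The lists are separate because peeling the head off
      -- the outer sum leaves it inside the products.
      rest : ℕ → List A → List A → Carrier
      rest t ys xs = ∑ xs (λ w → ⟦ not (key w <ᵇ t) ⟧ * (v w * ∏below (key w) ys))

      n<ᵇn : ∀ n → (n <ᵇ n) ≡ false
      n<ᵇn zero    = ≡.refl
      n<ᵇn (suc n) = n<ᵇn n

      <ᵇ-asym : ∀ i j → ⟦ i <ᵇ j ⟧ ≤ ⟦ not (j <ᵇ i) ⟧
      <ᵇ-asym zero    zero    = 0≤1
      <ᵇ-asym zero    (suc j) = O.refl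
      <ᵇ-asym (suc i) zero    = O.refl
      <ᵇ-asym (suc i) (suc j) = <ᵇ-asym i j

    -- Generalises ∑-∏below-≤ to a threshold t that the induction can vary.
    threshold : ∀ t xs → ∏below t xs + rest t xs xs ≤ ∏ xs (λ x → 1# + v x)
    threshold t []       = O.reflexive (R.+-identityʳ 1#)
    threshold t (x ∷ xs) = begin
      (1# + ⟦ b ⟧ * v x) * P + (⟦ not b ⟧ * (v x * ((1# + ⟦ key x <ᵇ key x ⟧ * v x) * Q)) + rest t (x ∷ xs) xs)
        ≈⟨ R.+-cong R.refl (R.+-cong (R.*-congˡ (R.*-congˡ (R.*-congʳ (R.+-congˡ (R.*-congʳ
             (R.reflexive (≡.cong ⟦_⟧ (n<ᵇn (key x))))))))) expand) ⟩
      (1# + ⟦ b ⟧ * v x) * P + (⟦ not b ⟧ * (v x * ((1# + 0# * v x) * Q)) + (T + v x * T′))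
        ≤⟨ bound b (extra b) ⟩
      (1# + v x) * ∏ xs (λ x → 1# + v x) ∎
      where
      b = key x <ᵇ t
      P = ∏below t xs
      Q = ∏below (key x) xs
      T = rest t xs xs
      -- The part of the summand at w that acquires the factor `v x`: those w whose key exceeds that
      -- of x.
      crossing : A → Carrier
      crossing w = ⟦ not (key w <ᵇ t) ⟧ * (⟦ key x <ᵇ key w ⟧ * (v w * ∏below (key w) xs))
      T′ = ∑ xs crossing
      0≤vP : ∀ w → 0# ≤ v w * ∏below (key w) xs
      0≤vP w = *-nonNeg (0≤v w) (0≤∏below (key w) xs)
      expand : rest t (x ∷ xs) xs ≈ T + v x * T′
      expand = R.trans (∑-cong xs (λ w → solve 5
          (λ n u k y p → n :* (u :* ((con 1 :+ k :* y) :* p)) := n :* (u :* p) :+ y :* (n :* (k :* (u :* p))))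
          R.refl ⟦ not (key w <ᵇ t) ⟧ (v w) ⟦ key x <ᵇ key w ⟧ (v x) (∏below (key w) xs)))
        (R.trans (∑-distrib-+ xs _ _) (R.+-congˡ (R.sym (*-distribˡ-∑ (v x) xs crossing))))
      -- If x lies below t, the condition that w has a larger key than x is dropped. Otherwise the
      -- condition on t is dropped, and the comparison with x becomes the new threshold.
      extra : ∀ b → T′ ≤ (if b then T else rest (key x) xs xs)
      extra true  = ∑-mono-≤ xs (λ w → *-monoˡ-≤ (⟦⟧-nonNeg (not (key w <ᵇ t))) (⟦⟧*-≤ (key x <ᵇ key w) (0≤vP w)))
      extra false = ∑-mono-≤ xs (λ w → O.trans
        (⟦⟧*-≤ (not (key w <ᵇ t)) (*-nonNeg (⟦⟧-nonNeg (key x <ᵇ key w)) (0≤vP w)))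
        (*-monoʳ-≤ (0≤vP w) (<ᵇ-asym (key x) (key w))))
      bound : ∀ b → T′ ≤ (if b then T else rest (key x) xs xs) →
        (1# + ⟦ b ⟧ * v x) * P + (⟦ not b ⟧ * (v x * ((1# + 0# * v x) * Q)) + (T + v x * T′))
          ≤ (1# + v x) * ∏ xs (λ x → 1# + v x)
      bound true h = begin
        (1# + 1# * v x) * P + (0# * (v x * ((1# + 0# * v x) * Q)) + (T + v x * T′))
          ≤⟨ +-mono-≤ O.refl (+-mono-≤ O.refl (+-mono-≤ O.refl (*-monoˡ-≤ (0≤v x) h))) ⟩
        (1# + 1# * v x) * P + (0# * (v x * ((1# + 0# * v x) * Q)) + (T + v x * T))
          ≈⟨ solve 4 (λ y p q t → (con 1 :+ con 1 :* y) :* p :+ (con 0 :* (y :* ((con 1 :+ con 0 :* y) :* q)) :+ (t :+ y :* t))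
               := (con 1 :+ y) :* (p :+ t)) R.refl (v x) P Q T ⟩
        (1# + v x) * (P + T)
          ≤⟨ *-monoˡ-≤ (+-nonNeg 0≤1 (0≤v x)) (threshold t xs) ⟩
        (1# + v x) * ∏ xs (λ x → 1# + v x) ∎
      -- Now x is not below t. Subsets without x are controlled by the induction hypothesis at t,
      -- those with x by the one at `key x`.
      bound false h = begin
        (1# + 0# * v x) * P + (1# * (v x * ((1# + 0# * v x) * Q)) + (T + v x * T′))
          ≤⟨ +-mono-≤ O.refl (+-mono-≤ O.refl (+-mono-≤ O.refl (*-monoˡ-≤ (0≤v x) h))) ⟩
        (1# + 0# * v x) * P + (1# * (v x * ((1# + 0# * v x) * Q)) + (T + v x * rest (key x) xs xs))
          ≈⟨ solve 5 (λ y p q t s → (con 1 :+ con 0 :* y) :* p :+ (con 1 :* (y :* ((con 1 :+ con 0 :* y) :* q)) :+ (t :+ y :* s))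
               := (p :+ t) :+ y :* (q :+ s)) R.refl (v x) P Q T (rest (key x) xs xs) ⟩
        (P + T) + v x * (Q + rest (key x) xs xs)
          ≤⟨ +-mono-≤ (threshold t xs) (*-monoˡ-≤ (0≤v x) (threshold (key x) xs)) ⟩
        ∏ xs (λ x → 1# + v x) + v x * ∏ xs (λ x → 1# + v x)
          ≈⟨ solve 2 (λ y a → a :+ y :* a := (con 1 :+ y) :* a) R.refl (v x) (∏ xs (λ x → 1# + v x)) ⟩
        (1# + v x) * ∏ xs (λ x → 1# + v x) ∎

    -- The subsets of xs weighted by ∏ v, grouped by their element of largest key.
    ∑-∏below-≤ : ∀ xs → ∑ xs (λ w → v w * ∏below (key w) xs) ≤ ∏ xs (λ x → 1# + v x)
    ∑-∏below-≤ xs = begin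
      -- No key is below 0, so the bracket in `rest` computes to 1.
      ∑ xs (λ w → v w * ∏below (key w) xs)   ≈⟨ ∑-cong xs (λ w → R.sym (R.*-identityˡ _)) ⟩
      rest 0 xs xs                            ≤⟨ x≤x+y (0≤∏below 0 xs) ⟩
      rest 0 xs xs + ∏below 0 xs              ≈⟨ R.+-comm _ _ ⟩
      ∏below 0 xs + rest 0 xs xs              ≤⟨ threshold 0 xs ⟩
      ∏ xs (λ x → 1# + v x)                   ∎

-- Membership in decidable subsets.

does≡true⇒ : ∀ {p} {P : Set p} (d : Dec P) → does d ≡ true → P
does≡true⇒ (yes p) _ = p

∈-comprehension⁺ : ∀ {n p} {P : Pred (Fin n) p} (P? : Decidable P) {i} → P i → i ∈ comprehension P?
∈-comprehension⁺ P? {i} p = Vecₚ.lookup⇒[]= i _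
  (≡.trans (Vecₚ.lookup∘tabulate _ i) (dec-true (P? i) p))

∈-comprehension⁻ : ∀ {n p} {P : Pred (Fin n) p} (P? : Decidable P) {i} → i ∈ comprehension P? → P i
∈-comprehension⁻ P? {i} i∈ = does≡true⇒ (P? i)
  (≡.trans (≡.sym (Vecₚ.lookup∘tabulate _ i)) (Vecₚ.[]=⇒lookup i∈))

∈-elements⁺ : ∀ {n} {S : Subset n} {i} → i ∈ S → i ∈ˡ elements S
∈-elements⁺ {S = S} {i} = ∈-filter⁺ (_∈? S) (∈-allFin i)

-- Mass transported by one step from μ, bounded by the charges.

module Walk {c ℓ₁ ℓ₂} (ℝ : Reals c ℓ₁ ℓ₂) {n m} (D : FlawDigraph n m)
  (ρ : Fin m → Fin n → Fin n → Reals.Carrier ℝ) (θ μ : Fin n → Reals.Carrier ℝ)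
  (isTransition : IsTransition ℝ D ρ) (θ-dist : IsDistribution ℝ θ) (μ-dist : IsDistribution ℝ μ)
  (0<μ : ∀ σ → Reals._<_ ℝ (Reals.0# ℝ) (μ σ))
  where

  open Reals ℝ
  open FlawDigraph D
  open PermutationWalk ℝ D ρ θ
  open Charges μ
  open OrderedField ℝ
  open Sums ℝ
  open IsTransition isTransition
  open IsDistribution
  open PosetReasoning (TotalOrder.poset totalOrder)

  0≤μ : ∀ σ → 0# ≤ μ σ
  0≤μ σ = proj₁ (0<μ σ)

  0≤ρ : ∀ {i σ} τ → σ ∈ flaw i → 0# ≤ ρ i σ τ
  0≤ρ τ σ∈f = nonNeg (isDistribution σ∈f) τ

  inflow : Fin m → Fin n → Carrier
  inflow i τ = ∑ (elements (flaw i)) (λ σ → μ σ * ρ i σ τ)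

  inflow≈ : ∀ i τ → inflow i τ ≈ ∑ (allFin n) (λ σ → ⟦ does (σ ∈? flaw i) ⟧ * (μ σ * ρ i σ τ))
  inflow≈ i τ = ∑-filter (_∈? flaw i) (allFin n) _

  inflow-nonNeg : ∀ i τ → 0# ≤ inflow i τ
  inflow-nonNeg i τ = O.trans (∑-nonNeg (allFin n) (λ σ → ⟦does⟧*-nonNeg (σ ∈? flaw i)
    (λ σ∈f → *-nonNeg (0≤μ σ) (0≤ρ τ σ∈f)))) (O.reflexive (R.sym (inflow≈ i τ)))

  measure-pos : ∀ i → 0# < measure μ (flaw i)
  measure-pos i = let σ , σ∈f = flaw-nonempty i in
    <-≤-trans (0<μ σ) (∑-member-≤ μ 0≤μ (∈-elements⁺ σ∈f))

  bᵗ≤b : ∀ i τ → bᵗ i τ ℕ.≤ b i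
  bᵗ≤b i τ = All.lookup (ℕExtrema.xs≤max 0 _) (∈-map⁺ (bᵗ i) (∈-allFin τ))

  -- Each arc into τ carries at most `Λ * μ τ` by the definition of `λᵢ`, and at most `b i` arcs
  -- labelled i enter τ.
  inflow-≤-general : ∀ i τ → inflow i τ ≤ (fromℕ (b i) * maximum (elements (flaw i)) (λᵢ i)) * μ τ
  inflow-≤-general i τ = begin
    inflow i τ
      ≈⟨ inflow≈ i τ ⟩
    ∑ (allFin n) (λ σ → ⟦ does (σ ∈? flaw i) ⟧ * (μ σ * ρ i σ τ))
      ≤⟨ ∑-mono-≤ (allFin n) (λ σ → arc-≤ σ (σ ∈? flaw i) (τ ∈? A i σ)) ⟩
    ∑ (allFin n) (λ σ → ⟦ does (arc? i σ τ) ⟧ * (Λ * μ τ))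
      ≈⟨ *-distribʳ-∑ (Λ * μ τ) (allFin n) _ ⟨
    ∑ (allFin n) (λ σ → ⟦ does (arc? i σ τ) ⟧) * (Λ * μ τ)
      ≈⟨ R.*-congʳ (∑-⟦⟧ (λ σ → arc? i σ τ) (allFin n)) ⟩
    fromℕ (bᵗ i τ) * (Λ * μ τ)
      ≤⟨ *-monoʳ-≤ (*-nonNeg 0≤Λ (0≤μ τ)) (fromℕ-mono-≤ (bᵗ≤b i τ)) ⟩
    fromℕ (b i) * (Λ * μ τ)
      ≈⟨ R.*-assoc _ Λ (μ τ) ⟨
    (fromℕ (b i) * Λ) * μ τ ∎
    where
    Λ = maximum (elements (flaw i)) (λᵢ i)
    0≤Λ : 0# ≤ Λ
    0≤Λ = maximum-nonNeg (elements (flaw i)) (λᵢ i)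
    arc-≤ : ∀ σ (d : Dec (σ ∈ flaw i)) (e : Dec (τ ∈ A i σ)) →
      ⟦ does d ⟧ * (μ σ * ρ i σ τ) ≤ ⟦ does (d ×-dec e) ⟧ * (Λ * μ τ)
    arc-≤ σ (no _) e = O.reflexive (R.trans (R.zeroˡ _) (R.sym (R.zeroˡ _)))
    arc-≤ σ (yes σ∈f) (no τ∉A) = O.reflexive (R.trans
      (R.trans (R.*-identityˡ _) (R.trans (R.*-congˡ (support σ∈f τ∉A)) (R.zeroʳ _))) (R.sym (R.zeroˡ _)))
    arc-≤ σ (yes σ∈f) (yes τ∈A) = *-monoˡ-≤ 0≤1 (begin
      μ σ * ρ i σ τ                       ≈⟨ R.*-identityʳ _ ⟨
      (μ σ * ρ i σ τ) * 1#                ≈⟨ R.*-congˡ (*-inverseˡ (0<μ τ)) ⟨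
      (μ σ * ρ i σ τ) * (μ τ ⁻¹ * μ τ)    ≈⟨ solve 4 (λ s r u t → (s :* r) :* (u :* t) := (r :* (s :* u)) :* t)
                                                R.refl (μ σ) (ρ i σ τ) (μ τ ⁻¹) (μ τ) ⟩
      (ρ i σ τ * (μ σ / μ τ)) * μ τ       ≤⟨ *-monoʳ-≤ (0≤μ τ) (≤-maximum _ (∈-elements⁺ τ∈A)) ⟩
      λᵢ i σ * μ τ                        ≤⟨ *-monoʳ-≤ (0≤μ τ) (≤-maximum (λᵢ i) (∈-elements⁺ σ∈f)) ⟩
      Λ * μ τ                             ∎)

  -- The only property of the charges that is used.
  inflow-≤ : ∀ i τ → inflow i τ ≤ γ i * μ τ
  inflow-≤ i τ = byCase regenerativeCase?
    where
    M = measure μ (flaw i)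
    -- Taking the decision as an argument lets the `if` inside `γ i` reduce in each case.
    byCase : (d : Dec RegenerativeCase) →
      inflow i τ ≤ (if does d then M else fromℕ (b i) * maximum (elements (flaw i)) (λᵢ i)) * μ τ
    byCase (no _) = inflow-≤-general i τ
    byCase (yes (regenerates , _)) = O.reflexive (begin-equality
      inflow i τ                ≈⟨ R.*-identityˡ _ ⟨
      1# * inflow i τ           ≈⟨ R.*-congʳ (*-inverseˡ (measure-pos i)) ⟨
      (M ⁻¹ * M) * inflow i τ   ≈⟨ solve 3 (λ u v w → (u :* v) :* w := v :* (u :* w)) R.refl (M ⁻¹) M (inflow i τ) ⟩
      M * (M ⁻¹ * inflow i τ)   ≈⟨ R.*-congˡ (regenerates i τ) ⟩
      M * μ τ                   ∎)

  -- The sign is read off from `inflow-≤` at any one state, without returning to the two definitions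
  -- of the charge.
  0≤γ : ∀ i → 0# ≤ γ i
  0≤γ i = let τ , _ = flaw-nonempty i in *-cancelˡ-≤ (0<μ τ) (begin
    μ τ * 0#     ≈⟨ R.zeroʳ _ ⟩
    0#           ≤⟨ inflow-nonNeg i τ ⟩
    inflow i τ   ≤⟨ inflow-≤ i τ ⟩
    γ i * μ τ    ≈⟨ R.*-comm _ _ ⟩
    μ τ * γ i    ∎)

  -- The permutation walk: survival probabilities and path sums.

  module _ (π : Permutation′ m) where

    key : Fin m → ℕ
    key j = toℕ (π ⟨$⟩ʳ j)

    key-injective : ∀ {i j} → key i ≡ key j → i ≡ j
    key-injective h = ≡.trans (≡.sym (inverseˡ π))
      (≡.trans (≡.cong (π ⟨$⟩ˡ_) (Finₚ.toℕ-injective h)) (inverseˡ π))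

    greatest⇒∈ : ∀ {σ i} → Greatest π σ i → σ ∈ flaw i
    greatest⇒∈ {σ} (i∈U , _) = ∈-comprehension⁻ (λ i → σ ∈? flaw i) i∈U

    noGreatest⇒sink : ∀ {σ} → ¬ ∃ (Greatest π σ) → Sink σ
    noGreatest⇒sink {σ} none i τ (σ∈f , _) = none (g , g∈U , λ j j∈U →
        All.lookup (ℕExtrema.f[xs]≤f[argmax] i (elements (U σ))) (∈-elements⁺ j∈U))
      where
      -- The flaw i of the supposed arc is the default value, and it is present at σ, so the result
      -- is present too.
      g = ℕExtrema.argmax key i (elements (U σ))
      g∈U : g ∈ U σ
      g∈U = ℕExtrema.argmax-all key {P = _∈ U σ} (∈-comprehension⁺ (λ i → σ ∈? flaw i) σ∈f)
        (Allₚ.all-filter (_∈? U σ) (allFin m))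

    chosen : Fin m → Fin n → Carrier
    chosen i σ = ⟦ does (greatest? π σ i) ⟧

    step-nonNeg : ∀ σ τ → 0# ≤ step π σ τ
    step-nonNeg σ τ with Finₚ.any? (greatest? π σ)
    ... | yes (_ , g) = 0≤ρ τ (greatest⇒∈ g)
    ... | no  _ with does (τ Finₚ.≟ σ)
    ...   | true  = 0≤1
    ...   | false = O.refl

    step-total : ∀ σ → ∑ (allFin n) (step π σ) ≈ 1#
    step-total σ with Finₚ.any? (greatest? π σ)
    ... | yes (_ , g) = total (isDistribution (greatest⇒∈ g))
    ... | no  _       = ∑-dirac σ

    chosen*ρ-nonNeg : ∀ σ τ i → 0# ≤ chosen i σ * ρ i σ τ
    chosen*ρ-nonNeg σ τ i = ⟦does⟧*-nonNeg (greatest? π σ i) (0≤ρ τ ∘ greatest⇒∈)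

    -- Replaces the case distinction inside `step` by a sum over flaws, which can be exchanged with
    -- sums over states. Where no flaw is greatest the state is a sink, and the bracket on the left
    -- vanishes.
    flawed-step-≤ : ∀ σ τ → ⟦ not (does (sink? σ)) ⟧ * step π σ τ ≤ ∑ (allFin m) (λ i → chosen i σ * ρ i σ τ)
    flawed-step-≤ σ τ with Finₚ.any? (greatest? π σ)
    ... | yes (i , g) = begin
      ⟦ not (does (sink? σ)) ⟧ * ρ i σ τ             ≤⟨ ⟦⟧*-≤ (not (does (sink? σ))) (0≤ρ τ (greatest⇒∈ g)) ⟩
      ρ i σ τ                                        ≈⟨ R.*-identityˡ _ ⟨
      1# * ρ i σ τ                                   ≈⟨ R.*-congʳ (R.reflexive (≡.cong ⟦_⟧ (dec-true (greatest? π σ i) g))) ⟨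
      chosen i σ * ρ i σ τ                           ≤⟨ ∑-member-≤ _ (chosen*ρ-nonNeg σ τ) (∈-allFin i) ⟩
      ∑ (allFin m) (λ i → chosen i σ * ρ i σ τ)      ∎
    ... | no none rewrite dec-true (sink? σ) (noGreatest⇒sink none) =
      O.trans (O.reflexive (R.zeroˡ _)) (∑-nonNeg (allFin m) (chosen*ρ-nonNeg σ τ))

    -- The probability that the walk from σ makes t steps, that is, that its first t states are not
    -- sinks.
    survive : ℕ → Fin n → Carrier
    survive zero    σ = 1#
    survive (suc t) σ = ⟦ not (does (sink? σ)) ⟧ * ∑ (allFin n) (λ τ → step π σ τ * survive t τ)

    survive-nonNeg : ∀ t σ → 0# ≤ survive t σ
    survive-nonNeg zero    σ = 0≤1
    survive-nonNeg (suc t) σ = *-nonNeg (⟦⟧-nonNeg (not (does (sink? σ))))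
      (∑-nonNeg (allFin n) (λ τ → *-nonNeg (step-nonNeg σ τ) (survive-nonNeg t τ)))

    hits? : ∀ {t} (w : Vec (Fin n) t) → Dec (VecAny.Any Sink w)
    hits? = VecAny.any? sink?

    steps-total : ∀ t σ → ∑ (vectors (allFin n) t) (λ w → steps π (σ Vec.∷ w)) ≈ 1#
    steps-total zero    σ = R.+-identityʳ 1#
    steps-total (suc t) σ = begin-equality
      ∑ (vectors (allFin n) (suc t)) (λ w → steps π (σ Vec.∷ w))
        ≈⟨ ∑-cartesianProductWith Vec._∷_ (allFin n) (vectors (allFin n) t) _ ⟩
      ∑ (allFin n) (λ τ → ∑ (vectors (allFin n) t) (λ w → step π σ τ * steps π (τ Vec.∷ w)))
        ≈⟨ ∑-cong (allFin n) (λ τ → *-distribˡ-∑ (step π σ τ) (vectors (allFin n) t) _) ⟨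
      ∑ (allFin n) (λ τ → step π σ τ * ∑ (vectors (allFin n) t) (λ w → steps π (τ Vec.∷ w)))
        ≈⟨ ∑-cong (allFin n) (λ τ → R.trans (R.*-congˡ (steps-total t τ)) (R.*-identityʳ _)) ⟩
      ∑ (allFin n) (step π σ)
        ≈⟨ step-total σ ⟩
      1# ∎

    -- A path of t steps that avoids the sinks can be extended by one more step.
    survive-suc : ∀ t σ →
      ∑ (vectors (allFin n) t) (λ w → ⟦ not (does (hits? (σ Vec.∷ w))) ⟧ * steps π (σ Vec.∷ w)) ≈ survive (suc t) σ
    survive-suc zero σ = begin-equality
      ⟦ not (does (sink? σ) ∨ false) ⟧ * 1# + 0#
        ≈⟨ R.trans (R.+-identityʳ _) (R.*-identityʳ _) ⟩
      ⟦ not (does (sink? σ) ∨ false) ⟧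
        ≈⟨ R.trans (⟦not∨⟧ (does (sink? σ)) false) (R.*-congˡ (R.sym (step-total σ))) ⟩
      ⟦ not (does (sink? σ)) ⟧ * ∑ (allFin n) (step π σ)
        ≈⟨ R.*-congˡ (∑-cong (allFin n) (λ τ → R.*-identityʳ _)) ⟨
      ⟦ not (does (sink? σ)) ⟧ * ∑ (allFin n) (λ τ → step π σ τ * 1#) ∎
    survive-suc (suc t) σ = begin-equality
      ∑ (vectors (allFin n) (suc t)) (λ w → ⟦ not (does (hits? (σ Vec.∷ w))) ⟧ * steps π (σ Vec.∷ w))
        ≈⟨ ∑-cartesianProductWith Vec._∷_ (allFin n) ws _ ⟩
      ∑ (allFin n) (λ τ → ∑ ws (λ w →
        ⟦ not (does (sink? σ) ∨ does (hits? (τ Vec.∷ w))) ⟧ * (step π σ τ * steps π (τ Vec.∷ w))))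
        ≈⟨ ∑-cong (allFin n) (λ τ → R.trans
             (∑-cong ws (λ w → R.trans (R.*-congʳ (⟦not∨⟧ (does (sink? σ)) (does (hits? (τ Vec.∷ w)))))
               (solve 4 (λ a b s p → (a :* b) :* (s :* p) := (a :* s) :* (b :* p)) R.refl
                 N ⟦ not (does (hits? (τ Vec.∷ w))) ⟧ (step π σ τ) (steps π (τ Vec.∷ w)))))
             (R.sym (*-distribˡ-∑ (N * step π σ τ) ws _))) ⟩
      ∑ (allFin n) (λ τ → (N * step π σ τ) * ∑ ws (λ w → ⟦ not (does (hits? (τ Vec.∷ w))) ⟧ * steps π (τ Vec.∷ w)))
        ≈⟨ ∑-cong (allFin n) (λ τ → R.trans (R.*-congˡ (survive-suc t τ)) (R.*-assoc _ _ _)) ⟩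
      ∑ (allFin n) (λ τ → N * (step π σ τ * survive (suc t) τ))
        ≈⟨ *-distribˡ-∑ N (allFin n) _ ⟨
      N * ∑ (allFin n) (λ τ → step π σ τ * survive (suc t) τ) ∎
      where
      N = ⟦ not (does (sink? σ)) ⟧
      ws = vectors (allFin n) t

    -- A path of t steps has t + 1 states. If none of them is a sink, the walk makes step t + 1 as
    -- well, hence the index `suc t`.
    Pr-complement : ∀ t → Pr[sink-within t steps] π + ∑ (allFin n) (λ σ → θ σ * survive (suc t) σ) ≈ 1#
    Pr-complement t = begin-equality
      Pr[sink-within t steps] π + ∑ (allFin n) (λ σ → θ σ * survive (suc t) σ)
        ≈⟨ R.+-congˡ missing ⟨
      Pr[sink-within t steps] π + ∑ (vectors (allFin n) (suc t)) (λ w → ⟦ not (does (hits? w)) ⟧ * pathProbability π w)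
        ≈⟨ ∑-filter-complement hits? (vectors (allFin n) (suc t)) (pathProbability π) ⟩
      ∑ (vectors (allFin n) (suc t)) (pathProbability π)
        ≈⟨ ∑-cartesianProductWith Vec._∷_ (allFin n) ws _ ⟩
      ∑ (allFin n) (λ σ → ∑ ws (λ w → θ σ * steps π (σ Vec.∷ w)))
        ≈⟨ ∑-cong (allFin n) (λ σ → R.trans (R.sym (*-distribˡ-∑ (θ σ) ws _))
             (R.trans (R.*-congˡ (steps-total t σ)) (R.*-identityʳ _))) ⟩
      ∑ (allFin n) θ
        ≈⟨ total θ-dist ⟩
      1# ∎
      where
      ws = vectors (allFin n) t
      missing : ∑ (vectors (allFin n) (suc t)) (λ w → ⟦ not (does (hits? w)) ⟧ * pathProbability π w) ≈
                ∑ (allFin n) (λ σ → θ σ * survive (suc t) σ)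
      missing = begin-equality
        ∑ (vectors (allFin n) (suc t)) (λ w → ⟦ not (does (hits? w)) ⟧ * pathProbability π w)
          ≈⟨ ∑-cartesianProductWith Vec._∷_ (allFin n) ws _ ⟩
        ∑ (allFin n) (λ σ → ∑ ws (λ w → ⟦ not (does (hits? (σ Vec.∷ w))) ⟧ * (θ σ * steps π (σ Vec.∷ w))))
          ≈⟨ ∑-cong (allFin n) (λ σ → R.trans
               (∑-cong ws (λ w → solve 3 (λ a u s → a :* (u :* s) := u :* (a :* s)) R.refl
                 ⟦ not (does (hits? (σ Vec.∷ w))) ⟧ (θ σ) (steps π (σ Vec.∷ w))))
               (R.sym (*-distribˡ-∑ (θ σ) ws _))) ⟩
        ∑ (allFin n) (λ σ → θ σ * ∑ ws (λ w → ⟦ not (does (hits? (σ Vec.∷ w))) ⟧ * steps π (σ Vec.∷ w)))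
          ≈⟨ ∑-cong (allFin n) (λ σ → R.*-congˡ (survive-suc t σ)) ⟩
        ∑ (allFin n) (λ σ → θ σ * survive (suc t) σ) ∎

  -- Weights of sets of flaws.

  module _ (ψ : Fin m → Carrier) (0<ψ : ∀ i → 0# < ψ i) where

    z : Carrier
    z = maximum (allFin m) (ζ ψ)

    0≤z : 0# ≤ z
    0≤z = maximum-nonNeg (allFin m) (ζ ψ)

    -- The inequality ζ_i ≤ z with the denominator `ψ i` cleared.
    γ*weight≤z*ψ : ∀ i → γ i * weight ψ (Γ i) ≤ z * ψ i
    γ*weight≤z*ψ i = begin
      γ i * W                       ≈⟨ R.*-identityʳ _ ⟨
      (γ i * W) * 1#                ≈⟨ R.*-congˡ (*-inverseˡ (0<ψ i)) ⟨
      (γ i * W) * (ψ i ⁻¹ * ψ i)    ≈⟨ solve 4 (λ g w u p → (g :* w) :* (u :* p) := ((g :* u) :* w) :* p) R.refl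
                                         (γ i) W (ψ i ⁻¹) (ψ i) ⟩
      ζ ψ i * ψ i                   ≤⟨ *-monoʳ-≤ (proj₁ (0<ψ i)) (≤-maximum (ζ ψ) (∈-allFin i)) ⟩
      z * ψ i                       ∎
      where W = weight ψ (Γ i)

    restrict : (Fin m → Bool) → Fin m → Carrier
    restrict V j = ⟦ V j ⟧ * ψ j

    restrict-nonNeg : ∀ V j → 0# ≤ restrict V j
    restrict-nonNeg V j = *-nonNeg (⟦⟧-nonNeg (V j)) (proj₁ (0<ψ j))

    -- This is w(V) of the overview. Sets of flaws are Boolean functions here, so that `next` can be
    -- defined pointwise.
    potential : (Fin m → Bool) → Carrier
    potential V = ∏ (allFin m) (λ j → 1# + restrict V j)

    1≤potential : ∀ V → 1# ≤ potential V
    1≤potential V = 1≤∏ (allFin m) (λ j → x≤x+y (restrict-nonNeg V j))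

    weight≈potential : ∀ S → weight ψ S ≈ potential (lookup S)
    weight≈potential = subset-weight ψ

    -- Flaws present after one step, and the induction on the number of steps.

    module _ (π : Permutation′ m) where

      below : (Fin m → Bool) → Fin m → Carrier
      below V w = ∏below (key π) (restrict V) (restrict-nonNeg V) (key π w) (allFin m)

      -- If all flaws present lie in V and w, the greatest of them, is addressed,
      -- then each flaw present afterwards is either smaller than w or caused by w.
      next : (Fin m → Bool) → Fin m → Fin m → Bool
      next V w j = (V j ∧ (key π j <ᵇ key π w)) ∨ lookup (Γ w) j

      -- The weight w is submultiplicative on unions: an element of the union contributes its factor
      -- to at least one of the two products, and all other factors are at least 1.
      potential-next : ∀ V w → potential (next V w) ≤ below V w * weight ψ (Γ w)
      potential-next V w = begin
        potential (next V w)
          ≤⟨ ∏-mono-≤ (allFin m) (λ j → +-nonNeg 0≤1 (restrict-nonNeg (next V w) j))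
               (λ j → factor (V j) (key π j <ᵇ key π w) (lookup (Γ w) j) (proj₁ (0<ψ j))) ⟩
        ∏ (allFin m) (λ j → (1# + ⟦ key π j <ᵇ key π w ⟧ * restrict V j) * (1# + restrict (lookup (Γ w)) j))
          ≈⟨ ∏-distrib-* (allFin m) _ _ ⟩
        below V w * potential (lookup (Γ w))
          ≈⟨ R.*-congˡ (weight≈potential (Γ w)) ⟨
        below V w * weight ψ (Γ w) ∎
        where
        ⟦∧∨⟧-≤ : ∀ a b c → ⟦ (a ∧ b) ∨ c ⟧ ≤ ⟦ b ⟧ * ⟦ a ⟧ + ⟦ c ⟧
        ⟦∧∨⟧-≤ true  true  c     = O.trans (⟦⟧-≤1 (true ∨ c))
          (O.trans (O.reflexive (R.sym (R.*-identityˡ 1#))) (x≤x+y (⟦⟧-nonNeg c)))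
        ⟦∧∨⟧-≤ true  false c     = O.reflexive (solve 1 (λ c → c := con 0 :* con 1 :+ c) R.refl ⟦ c ⟧)
        ⟦∧∨⟧-≤ false b     c     = O.reflexive (solve 2 (λ b c → c := b :* con 0 :+ c) R.refl ⟦ b ⟧ ⟦ c ⟧)
        factor : ∀ a b c {y} → 0# ≤ y → 1# + ⟦ (a ∧ b) ∨ c ⟧ * y ≤ (1# + ⟦ b ⟧ * (⟦ a ⟧ * y)) * (1# + ⟦ c ⟧ * y)
        factor a b c {y} 0≤y = begin
          1# + ⟦ (a ∧ b) ∨ c ⟧ * y
            ≤⟨ +-mono-≤ O.refl (*-monoʳ-≤ 0≤y (⟦∧∨⟧-≤ a b c)) ⟩
          1# + (⟦ b ⟧ * ⟦ a ⟧ + ⟦ c ⟧) * y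
            ≤⟨ x≤x+y (*-nonNeg (*-nonNeg (⟦⟧-nonNeg b) (*-nonNeg (⟦⟧-nonNeg a) 0≤y)) (*-nonNeg (⟦⟧-nonNeg c) 0≤y)) ⟩
          (1# + (⟦ b ⟧ * ⟦ a ⟧ + ⟦ c ⟧) * y) + (⟦ b ⟧ * (⟦ a ⟧ * y)) * (⟦ c ⟧ * y)
            ≈⟨ solve 4 (λ a b c y → (con 1 :+ (b :* a :+ c) :* y) :+ (b :* (a :* y)) :* (c :* y)
                 := (con 1 :+ b :* (a :* y)) :* (con 1 :+ c :* y)) R.refl ⟦ a ⟧ ⟦ b ⟧ ⟦ c ⟧ y ⟩
          (1# + ⟦ b ⟧ * (⟦ a ⟧ * y)) * (1# + ⟦ c ⟧ * y) ∎

      -- The contrapositive of "all flaws present where p is nonzero lie in V"; it yields equations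
      -- that make whole summands vanish.
      SupportedIn : (Fin m → Bool) → (Fin n → Carrier) → Set ℓ₁
      SupportedIn V p = ∀ σ j → σ ∈ flaw j → V j ≡ false → p σ ≈ 0#

      advance : (Fin n → Carrier) → Fin m → Fin n → Carrier
      advance p i τ = ∑ (allFin n) (λ σ → p σ * (chosen π i σ * ρ i σ τ))

      advance-nonNeg : ∀ {p} → (∀ σ → 0# ≤ p σ) → ∀ i τ → 0# ≤ advance p i τ
      advance-nonNeg 0≤p i τ = ∑-nonNeg (allFin n) (λ σ → *-nonNeg (0≤p σ) (chosen*ρ-nonNeg π σ τ i))

      -- A flaw j present at τ but not caused by i was present at σ already, below the addressed
      -- flaw i. If `next V i` omits j, then so does V, and p vanishes at σ.
      advance-supported : ∀ {p V} → SupportedIn V p → ∀ i → SupportedIn (next V i) (advance p i)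
      advance-supported {p} {V} p⊆V i τ j τ∈f j∉next = ∑-zero (allFin n) (λ σ → vanishes σ (greatest? π σ i))
        where
        caused : CausalityArc i j → lookup (Γ i) j ≡ false → ∀ {x} → x ≈ 0#
        caused arc h with ≡.trans (≡.sym h) (Vecₚ.[]=⇒lookup (∈-comprehension⁺ (causalityArc? i) arc))
        ... | ()
        split : ∀ {a b c} → (a ∧ b) ∨ c ≡ false → b ≡ true → a ≡ false
        split {false} _ _ = ≡.refl
        split {true} {true} () _
        ∨-falseʳ : ∀ {a c} → a ∨ c ≡ false → c ≡ false
        ∨-falseʳ {false} h = h
        vanishes : ∀ σ (d : Dec (Greatest π σ i)) → p σ * (⟦ does d ⟧ * ρ i σ τ) ≈ 0#
        vanishes σ (no _) = R.trans (R.*-congˡ (R.zeroˡ _)) (R.zeroʳ _)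
        vanishes σ (yes g) with τ ∈? A i σ
        ... | no τ∉A = R.trans (R.*-congˡ (R.trans (R.*-identityˡ _) (support (greatest⇒∈ π g) τ∉A))) (R.zeroʳ _)
        ... | yes τ∈A with causes? σ τ i j
        ...   | yes causes = caused (σ , τ , (greatest⇒∈ π g , τ∈A) , causes) (∨-falseʳ j∉next)
        ...   | no ¬causes with σ ∈? flaw j
        ...     | no σ∉f = ⊥-elim (¬causes (τ∈f , inj₂ σ∉f))
        ...     | yes σ∈f = R.trans (R.*-congʳ (p⊆V σ j σ∈f (split j∉next (≡true (ℕₚ.<⇒<ᵇ j<i))))) (R.zeroˡ _)
          where
          ≡true : ∀ {b} → Bool.T b → b ≡ true
          ≡true {true} _ = ≡.refl
          j<i : key π j ℕ.< key π i
          -- A flaw still present after being addressed counts as causing itself, so j differs from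
          -- i and the inequality is strict.
          j<i = ℕₚ.≤∧≢⇒< (proj₂ g j (∈-comprehension⁺ (λ j → σ ∈? flaw j) σ∈f))
            (λ e → ¬causes (τ∈f , inj₁ (key-injective π e)))

      -- For i outside V, p vanishes wherever i is addressed. For i in V, p is at most c μ on
      -- `flaw i`, and the charge bounds the inflow from there.
      advance-≤ : ∀ {p V c} → 0# ≤ c → (∀ σ → p σ ≤ c * μ σ) → SupportedIn V p →
                  ∀ i τ → advance p i τ ≤ (c * (⟦ V i ⟧ * γ i)) * μ τ
      advance-≤ {p} {V} {c} 0≤c p≤cμ p⊆V i τ with V i in Vi
      ... | false = O.reflexive (R.trans (∑-zero (allFin n) (λ σ → vanishes σ (greatest? π σ i)))
                      (R.sym (solve 3 (λ c g u → (c :* (con 0 :* g)) :* u := con 0) R.refl c (γ i) (μ τ))))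
        where
        vanishes : ∀ σ (d : Dec (Greatest π σ i)) → p σ * (⟦ does d ⟧ * ρ i σ τ) ≈ 0#
        vanishes σ (no _) = R.trans (R.*-congˡ (R.zeroˡ _)) (R.zeroʳ _)
        vanishes σ (yes g) = R.trans (R.*-congʳ (p⊆V σ i (greatest⇒∈ π g) Vi)) (R.zeroˡ _)
      ... | true = begin
        advance p i τ
          ≤⟨ ∑-mono-≤ (allFin n) (λ σ → bound σ (greatest? π σ i) (σ ∈? flaw i)) ⟩
        ∑ (allFin n) (λ σ → c * (⟦ does (σ ∈? flaw i) ⟧ * (μ σ * ρ i σ τ)))
          ≈⟨ *-distribˡ-∑ c (allFin n) _ ⟨
        c * ∑ (allFin n) (λ σ → ⟦ does (σ ∈? flaw i) ⟧ * (μ σ * ρ i σ τ))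
          ≈⟨ R.*-congˡ (inflow≈ i τ) ⟨
        c * inflow i τ
          ≤⟨ *-monoˡ-≤ 0≤c (inflow-≤ i τ) ⟩
        c * (γ i * μ τ)
          ≈⟨ solve 3 (λ c g u → c :* (g :* u) := (c :* (con 1 :* g)) :* u) R.refl c (γ i) (μ τ) ⟩
        (c * (1# * γ i)) * μ τ ∎
        where
        -- The sum grows from the states where i is greatest to all of `flaw i`.
        bound : ∀ σ (d : Dec (Greatest π σ i)) (e : Dec (σ ∈ flaw i)) →
          p σ * (⟦ does d ⟧ * ρ i σ τ) ≤ c * (⟦ does e ⟧ * (μ σ * ρ i σ τ))
        bound σ (no _) e = O.trans (O.reflexive (R.trans (R.*-congˡ (R.zeroˡ _)) (R.zeroʳ _)))
          (*-nonNeg 0≤c (⟦does⟧*-nonNeg e (λ σ∈f → *-nonNeg (0≤μ σ) (0≤ρ τ σ∈f))))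
        bound σ (yes g) (no σ∉f) = ⊥-elim (σ∉f (greatest⇒∈ π g))
        bound σ (yes g) (yes σ∈f) = O.trans
          (*-monoʳ-≤ (*-nonNeg 0≤1 (0≤ρ τ σ∈f)) (p≤cμ σ))
          (O.reflexive (solve 3 (λ c u r → (c :* u) :* (con 1 :* r) := c :* (con 1 :* (u :* r))) R.refl c (μ σ) (ρ i σ τ)))

      -- Conditions on the first step and on the flaw it addresses, then moves the sum over flaws
      -- outermost.
      survive-split : ∀ {p} → (∀ σ → 0# ≤ p σ) → ∀ t →
        ∑ (allFin n) (λ σ → p σ * survive π (suc t) σ) ≤
        ∑ (allFin m) (λ i → ∑ (allFin n) (λ τ → advance p i τ * survive π t τ))
      survive-split {p} 0≤p t = begin
        ∑ Ω (λ σ → p σ * (N σ * ∑ Ω (λ τ → step π σ τ * s τ)))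
          ≈⟨ ∑-cong Ω (λ σ → R.trans (R.sym (R.*-assoc _ _ _)) (*-distribˡ-∑ (p σ * N σ) Ω _)) ⟩
        ∑ Ω (λ σ → ∑ Ω (λ τ → (p σ * N σ) * (step π σ τ * s τ)))
          ≤⟨ ∑-mono-≤ Ω (λ σ → ∑-mono-≤ Ω (λ τ → O.trans
               (O.reflexive (solve 4 (λ p n q s → (p :* n) :* (q :* s) := (p :* s) :* (n :* q)) R.refl (p σ) (N σ) (step π σ τ) (s τ)))
               (*-monoˡ-≤ (*-nonNeg (0≤p σ) (survive-nonNeg π t τ)) (flawed-step-≤ π σ τ)))) ⟩
        ∑ Ω (λ σ → ∑ Ω (λ τ → (p σ * s τ) * ∑ (allFin m) (λ i → chosen π i σ * ρ i σ τ)))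
          ≈⟨ ∑-cong Ω (λ σ → ∑-cong Ω (λ τ → *-distribˡ-∑ (p σ * s τ) (allFin m) _)) ⟩
        ∑ Ω (λ σ → ∑ Ω (λ τ → ∑ (allFin m) (λ i → (p σ * s τ) * (chosen π i σ * ρ i σ τ))))
          ≈⟨ ∑-swap Ω Ω _ ⟩
        ∑ Ω (λ τ → ∑ Ω (λ σ → ∑ (allFin m) (λ i → (p σ * s τ) * (chosen π i σ * ρ i σ τ))))
          ≈⟨ ∑-cong Ω (λ τ → ∑-swap Ω (allFin m) _) ⟩
        ∑ Ω (λ τ → ∑ (allFin m) (λ i → ∑ Ω (λ σ → (p σ * s τ) * (chosen π i σ * ρ i σ τ))))
          ≈⟨ ∑-swap Ω (allFin m) _ ⟩
        ∑ (allFin m) (λ i → ∑ Ω (λ τ → ∑ Ω (λ σ → (p σ * s τ) * (chosen π i σ * ρ i σ τ))))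
          ≈⟨ ∑-cong (allFin m) (λ i → ∑-cong Ω (λ τ → R.trans
               (∑-cong Ω (λ σ → solve 3 (λ p s q → (p :* s) :* q := (p :* q) :* s) R.refl (p σ) (s τ) (chosen π i σ * ρ i σ τ)))
               (R.sym (*-distribʳ-∑ (s τ) Ω _)))) ⟩
        ∑ (allFin m) (λ i → ∑ Ω (λ τ → advance p i τ * s τ)) ∎
        where
        Ω = allFin n
        s = survive π t
        N : Fin n → Carrier
        N σ = ⟦ not (does (sink? σ)) ⟧

      -- The induction of the overview. It is stated for all p, V and c because a step addressing i
      -- replaces them by `advance p i`, `next V i` and c multiplied by `⟦ V i ⟧ * γ i`.
      survive-≤ : ∀ t {p V c} → 0# ≤ c → (∀ σ → 0# ≤ p σ) → (∀ σ → p σ ≤ c * μ σ) → SupportedIn V p →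
                  ∑ (allFin n) (λ σ → p σ * survive π t σ) ≤ c * (z ^ t * potential V)
      survive-≤ zero {p} {V} {c} 0≤c 0≤p p≤cμ p⊆V = begin
        ∑ (allFin n) (λ σ → p σ * 1#)      ≤⟨ ∑-mono-≤ (allFin n) (λ σ → O.trans (O.reflexive (R.*-identityʳ _)) (p≤cμ σ)) ⟩
        ∑ (allFin n) (λ σ → c * μ σ)       ≈⟨ *-distribˡ-∑ c (allFin n) μ ⟨
        c * ∑ (allFin n) μ                 ≈⟨ R.*-congˡ (total μ-dist) ⟩
        c * 1#                             ≤⟨ *-monoˡ-≤ 0≤c (1≤potential V) ⟩
        c * potential V                    ≈⟨ R.*-congˡ (R.*-identityˡ _) ⟨
        c * (1# * potential V)             ∎
      survive-≤ (suc t) {p} {V} {c} 0≤c 0≤p p≤cμ p⊆V = begin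
        ∑ (allFin n) (λ σ → p σ * survive π (suc t) σ)
          ≤⟨ survive-split 0≤p t ⟩
        ∑ (allFin m) (λ i → ∑ (allFin n) (λ τ → advance p i τ * survive π t τ))
          ≤⟨ ∑-mono-≤ (allFin m) (λ i → O.trans
               (survive-≤ t (*-nonNeg 0≤c (*-nonNeg (⟦⟧-nonNeg (V i)) (0≤γ i)))
                 (advance-nonNeg 0≤p i) (advance-≤ 0≤c p≤cμ p⊆V i) (advance-supported p⊆V i))
               (charge i)) ⟩
        ∑ (allFin m) (λ i → (c * z ^ suc t) * (restrict V i * below V i))
          ≈⟨ *-distribˡ-∑ (c * z ^ suc t) (allFin m) _ ⟨
        (c * z ^ suc t) * ∑ (allFin m) (λ i → restrict V i * below V i)
          ≤⟨ *-monoˡ-≤ (*-nonNeg 0≤c (^-nonNeg (suc t) 0≤z))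
               (∑-∏below-≤ (key π) (restrict V) (restrict-nonNeg V) (allFin m)) ⟩
        (c * z ^ suc t) * potential V
          ≈⟨ R.*-assoc _ _ _ ⟩
        c * (z ^ suc t * potential V) ∎
        where
        -- The factor w(Γ(i)) is absorbed by the charge, which yields `ψ i` and one further power of
        -- z.
        charge : ∀ i → (c * (⟦ V i ⟧ * γ i)) * (z ^ t * potential (next V i)) ≤ (c * z ^ suc t) * (restrict V i * below V i)
        charge i = begin
          (c * (v * γ i)) * (z ^ t * potential (next V i))
            ≤⟨ *-monoˡ-≤ (*-nonNeg 0≤c (*-nonNeg 0≤v (0≤γ i)))
                 (*-monoˡ-≤ (^-nonNeg t 0≤z) (potential-next V i)) ⟩
          (c * (v * γ i)) * (z ^ t * (B * W))
            ≈⟨ solve 6 (λ c v g q b w → (c :* (v :* g)) :* (q :* (b :* w)) := (((c :* v) :* q) :* b) :* (g :* w))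
                 R.refl c v (γ i) (z ^ t) B W ⟩
          (((c * v) * z ^ t) * B) * (γ i * W)
            ≤⟨ *-monoˡ-≤ (*-nonNeg (*-nonNeg (*-nonNeg 0≤c 0≤v) (^-nonNeg t 0≤z))
                   (∏-nonNeg (allFin m) (λ j → +-nonNeg 0≤1 (*-nonNeg (⟦⟧-nonNeg (key π j <ᵇ key π i)) (restrict-nonNeg V j)))))
                 (γ*weight≤z*ψ i) ⟩
          (((c * v) * z ^ t) * B) * (z * ψ i)
            ≈⟨ solve 6 (λ c v q b z p → (((c :* v) :* q) :* b) :* (z :* p) := (c :* (z :* q)) :* ((v :* p) :* b))
                 R.refl c v (z ^ t) B z (ψ i) ⟩
          (c * z ^ suc t) * (restrict V i * below V i) ∎
          where
          v = ⟦ V i ⟧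
          0≤v = ⟦⟧-nonNeg (V i)
          B = below V i
          W = weight ψ (Γ i)

    -- The initial distribution and `T₀`.

    M : Carrier
    M = maximum (allFin n) (λ σ → θ σ / μ σ)

    θ≤Mμ : ∀ σ → θ σ ≤ M * μ σ
    θ≤Mμ σ = begin
      θ σ                    ≈⟨ R.*-identityʳ _ ⟨
      θ σ * 1#               ≈⟨ R.*-congˡ (*-inverseˡ (0<μ σ)) ⟨
      θ σ * (μ σ ⁻¹ * μ σ)   ≈⟨ R.*-assoc _ _ _ ⟨
      (θ σ / μ σ) * μ σ      ≤⟨ *-monoʳ-≤ (0≤μ σ) (≤-maximum _ (∈-allFin σ)) ⟩
      M * μ σ                ∎

    -- Sum `θ≤Mμ` over all states; both distributions have total 1.
    1≤M : 1# ≤ M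
    1≤M = begin
      1#                            ≈⟨ total θ-dist ⟨
      ∑ (allFin n) θ                ≤⟨ ∑-mono-≤ (allFin n) θ≤Mμ ⟩
      ∑ (allFin n) (λ σ → M * μ σ)  ≈⟨ *-distribˡ-∑ M (allFin n) μ ⟨
      M * ∑ (allFin n) μ            ≈⟨ R.*-congˡ (total μ-dist) ⟩
      M * 1#                        ≈⟨ R.*-identityʳ M ⟩
      M                             ∎

    1≤weight : ∀ S → 1# ≤ weight ψ S
    1≤weight S = O.trans (1≤potential (lookup S)) (O.reflexive (R.sym (weight≈potential S)))

    2^T₀ : 2^ T₀ ψ ≈ M * weight ψ span
    2^T₀ = R.trans (2^-homo _ _) (R.*-cong (2^-log₂ M (<-≤-trans 0<1 1≤M))
      (2^-log₂ (weight ψ span) (<-≤-trans 0<1 (1≤weight span))))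

    -- Keeps the bound on the number of steps non-negative, as `floor` requires.
    0≤T₀ : 0# ≤ T₀ ψ
    0≤T₀ = 1≤2^x⇒0≤x (begin
      1#                    ≈⟨ R.*-identityˡ 1# ⟨
      1# * 1#               ≤⟨ *-mono-≤ 0≤1 (O.trans 0≤1 (1≤weight span)) 1≤M (1≤weight span) ⟩
      M * weight ψ span     ≈⟨ 2^T₀ ⟨
      2^ T₀ ψ               ∎)

    θ-supported : ∀ π → SupportedIn π (lookup span) θ
    θ-supported π σ j σ∈f j∉span with 0# <? θ σ
    ... | no 0≮θ with θ σ ≟ 0#
    ...   | yes θ≈0 = θ≈0
    ...   | no  θ≉0 = ⊥-elim (0≮θ (nonNeg θ-dist σ , λ e → θ≉0 (R.sym e)))
    θ-supported π σ j σ∈f j∉span | yes 0<θ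
      with ≡.trans (≡.sym j∉span) (Vecₚ.[]=⇒lookup (∈-comprehension⁺
             (λ i → Finₚ.any? (λ σ → 0# <? θ σ ×-dec i ∈? U σ))
             (σ , 0<θ , ∈-comprehension⁺ (λ i → σ ∈? flaw i) σ∈f)))
    ... | ()

    -- The induction is started at p = θ with c = M and V the span.
    failure-≤ : ∀ π t → ∑ (allFin n) (λ σ → θ σ * survive π t σ) ≤ 2^ T₀ ψ * z ^ t
    failure-≤ π t = begin
      ∑ (allFin n) (λ σ → θ σ * survive π t σ)
        ≤⟨ survive-≤ π t (O.trans 0≤1 1≤M) (nonNeg θ-dist) θ≤Mμ (θ-supported π) ⟩
      M * (z ^ t * potential (lookup span))
        ≈⟨ R.*-congˡ (R.*-congˡ (weight≈potential span)) ⟨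
      M * (z ^ t * weight ψ span)
        ≈⟨ solve 3 (λ m q w → m :* (q :* w) := (m :* w) :* q) R.refl M (z ^ t) (weight ψ span) ⟩
      (M * weight ψ span) * z ^ t
        ≈⟨ R.*-congʳ 2^T₀ ⟨
      2^ T₀ ψ * z ^ t ∎

    -- The decay rate and the number of steps.

    module _ (ζ<1 : ∀ i → ζ ψ i < 1#) where

      0<δ : 0# < δ ψ
      -- Here `0<1` handles the base value 0 of `maximum`, which is the maximum itself when m = 0.
      0<δ = x<y⇒0<y-x (Extrema.max<v⁺ totalOrder 0<1 (Allₚ.map⁺ (All.universal ζ<1 (allFin m))))

      -- The exponent is one more than the number of steps, so rounding
      -- (T₀ + s) / δ down costs nothing.
      2^T₀*z^t≤2^-s : ∀ {s} t → (T₀ ψ + s) / δ ψ ≤ fromℕ t → 2^ T₀ ψ * z ^ t ≤ 2^ (- s)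
      2^T₀*z^t≤2^-s {s} t h = begin
        2^ T₀ ψ * z ^ t                             ≈⟨ R.*-identityˡ _ ⟨
        1# * (2^ T₀ ψ * z ^ t)                      ≈⟨ R.*-congʳ (2^-inverseʳ s) ⟨
        (2^ s * 2^ (- s)) * (2^ T₀ ψ * z ^ t)       ≈⟨ solve 4 (λ a b c d → (a :* b) :* (c :* d) := b :* ((c :* a) :* d)) R.refl
                                                         (2^ s) (2^ (- s)) (2^ T₀ ψ) (z ^ t) ⟩
        2^ (- s) * ((2^ T₀ ψ * 2^ s) * z ^ t)       ≈⟨ R.*-congˡ (R.*-congʳ (2^-homo (T₀ ψ) s)) ⟨
        2^ (- s) * (2^ (T₀ ψ + s) * z ^ t)
          ≤⟨ *-monoˡ-≤ (2^-nonNeg (- s))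
               (*-monoʳ-≤ (^-nonNeg t 0≤z) (2^-mono-≤ T₀+s≤tδ)) ⟩
        2^ (- s) * (2^ (fromℕ t * δ ψ) * z ^ t)     ≈⟨ R.*-congˡ (R.*-congʳ (2^-fromℕ-* t (δ ψ))) ⟩
        2^ (- s) * ((2^ δ ψ) ^ t * z ^ t)           ≈⟨ R.*-congˡ (^-distrib-* (2^ δ ψ) z t) ⟨
        2^ (- s) * (2^ δ ψ * z) ^ t
          ≤⟨ *-monoˡ-≤ (2^-nonNeg (- s))
               (^-mono-≤ t (*-nonNeg (2^-nonNeg (δ ψ)) 0≤z) (2^d*y≤1 0≤z 0<δ z+δ≈1)) ⟩
        2^ (- s) * 1# ^ t                           ≈⟨ R.*-congˡ (1^k≈1 t) ⟩
        2^ (- s) * 1#                               ≈⟨ R.*-identityʳ _ ⟩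
        2^ (- s)                                    ∎
        where
        z+δ≈1 : z + δ ψ ≈ 1#
        z+δ≈1 = R.trans (R.+-comm z _) (x-y+y≈x 1# z)
        T₀+s≤tδ : T₀ ψ + s ≤ fromℕ t * δ ψ
        T₀+s≤tδ = begin
          T₀ ψ + s                           ≈⟨ R.*-identityʳ _ ⟨
          (T₀ ψ + s) * 1#                    ≈⟨ R.*-congˡ (*-inverseˡ 0<δ) ⟨
          (T₀ ψ + s) * (δ ψ ⁻¹ * δ ψ)        ≈⟨ R.*-assoc _ _ _ ⟨
          ((T₀ ψ + s) / δ ψ) * δ ψ           ≤⟨ *-monoʳ-≤ (proj₁ 0<δ) h ⟩
          fromℕ t * δ ψ                      ∎

      reachesSinkWithin : ∀ π s → 0# ≤ s → ReachesSinkWithin π ((T₀ ψ + s) / δ ψ) (1# - 2^ (- s))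
      reachesSinkWithin π s 0≤s =
        let t , t≤x , x≤1+t = floor (*-nonNeg (+-nonNeg 0≤T₀ 0≤s) (⁻¹-nonNeg 0<δ))
            Pr = Pr[sink-within t steps] π
            fail = ∑ (allFin n) (λ σ → θ σ * survive π (suc t) σ)
        -- Adding `2^ (- s)` to both sides reduces the claim to a bound on the failure probability.
        in t , t≤x , +-cancelʳ-≤ (2^ (- s)) (begin
          (1# - 2^ (- s)) + 2^ (- s)   ≈⟨ x-y+y≈x 1# (2^ (- s)) ⟩
          1#                           ≈⟨ Pr-complement π t ⟨
          Pr + fail                    ≤⟨ +-mono-≤ O.refl (O.trans (failure-≤ π (suc t)) (2^T₀*z^t≤2^-s (suc t) x≤1+t)) ⟩
          Pr + 2^ (- s)                ∎)

theorem2 : ∀ {c ℓ₁ ℓ₂} (ℝ : Reals c ℓ₁ ℓ₂) →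
    let open Reals ℝ in
    ∀ {n m : ℕ} (D : FlawDigraph n m)
    (ρ : Fin m → Fin n → Fin n → Carrier) (θ μ : Fin n → Carrier) →
    IsTransition ℝ D ρ → IsDistribution ℝ θ → IsDistribution ℝ μ →
    (∀ σ → 0# < μ σ) →
    let open PermutationWalk ℝ D ρ θ
        open Charges μ in
    (ψ : Fin m → Carrier) → (∀ i → 0# < ψ i) → (∀ i → ζ ψ i < 1#) →
    0# < δ ψ ×
    (∀ (π : Permutation′ m) (s : Carrier) → 0# ≤ s →
     ReachesSinkWithin π ((T₀ ψ + s) / δ ψ) (1# - 2^ (- s)))
theorem2 ℝ D ρ θ μ isTransition θ-dist μ-dist 0<μ ψ 0<ψ ζ<1 =
  0<δ ψ 0<ψ ζ<1 , reachesSinkWithin ψ 0<ψ ζ<1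
  where open Walk ℝ D ρ θ μ isTransition θ-dist μ-dist 0<μ
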